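{- Let $T$ and $U$ be two plane trees with the same even number $n$ of vertices. If $T$ and $U$ have different parities, then the rotation groups of the clean bipartite trees $T^c$ and $U^c$ are different: for any enumerations of the edges of $T^c$ and of $U^c$ by $1,\dots,2n-2$, the subgroups $R(T^c)$ and $R(U^c)$ of $S_{2n-2}$ do not coincide.
   Context: A plane tree is a finite tree embedded in the plane (equivalently, a tree with a cyclic counterclockwise order on the edges at each vertex). Parity: a pr-tree (plane rooted tree) is obtained from a plane tree by choosing a root vertex and a marked edge incident to the root. The children of each vertex are ordered from left to right: at the root, the edges are taken in counterclockwise order starting from the marked edge, and at any other vertex the edges to children are taken in counterclockwise order starting just after the edge to the parent. The bracket code of a pr-tree whose root has pr-subtrees $T_1,\dots,T_s$ (left to right) is recursively $(\,c(T_1)\cdots c(T_s)\,)$, where $c(T_i)$ is the code of $T_i$, and the one-vertex tree has code $()$. An inversion in a bracket code is a pair consisting of a closing bracket and an opening bracket, not necessarily adjacent, such that the closing bracket occurs before the opening bracket. A pr-tree is even if the number of inversions in its bracket code is even, and odd otherwise. For a plane tree with an even number of vertices this parity does not depend on the choice of root vertex and marked edge, so one speaks of even and odd plane trees. Rotation group: a bipartite tree is a tree with vertices colored black and white such that adjacent vertices have different colors. Let $T$ be a plane bipartite tree with $m$ edges enumerated by $M=\{1,\dots,m\}$. The permutation $s_w:M\to M$ is defined by $s_w(i)=j$ if the $i$-th and $j$-th edges are incident to the same white vertex $v$ and the $j$-th edge is the next after the $i$-th edge in going counterclockwise around $v$ (so $s_w(i)=i$ if $v$ has degree 1). The permutation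 $s_b$ is defined in the same way with respect to black vertices. The rotation group is $R(T)=\langle s_w,s_b\rangle\subset S_m$. Different enumerations of the edges give conjugate rotation groups. Clean tree: a bipartite tree is clean if all its black vertices have degree two. For a plane tree $T$, the clean plane bipartite tree $T^c$ is obtained by coloring all vertices of $T$ white and dividing each edge of $T$ into two edges by a new black vertex. If $T$ has $n$ vertices, $T^c$ has $2n-2$ edges. -}

module Defs where

open import Data.Bool using (Bool; true; false; not; if_then_else_)
import Data.Bool.Properties as Bool
open import Data.Empty using (⊥-elim)
open import Data.Fin using (Fin)
open import Data.Fin.Permutation using (Permutation′; _∘ₚ_; flip; _≈_)
  renaming (id to idₚ)
open import Data.Fin.Properties using (+↔⊎; *↔×; 2↔Bool)
open import Data.List using (List; []; _∷_; _++_; map)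
open import Data.List.Relation.Binary.Permutation.Propositional using (↭⇒↭ₛ)
import Data.List.Relation.Binary.Permutation.Propositional.Properties as Perm
open import Data.List.Relation.Binary.Permutation.Setoid.Properties using (Unique-resp-↭)
open import Data.List.Relation.Binary.Pointwise using (Pointwise)
open import Data.List.Relation.Unary.All using (All; []; _∷_)
open import Data.List.Relation.Unary.AllPairs using ([]; _∷_)
open import Data.List.Relation.Unary.Unique.Propositional using (Unique)
open import Data.Nat using (ℕ; zero; suc; _+_; _*_; parity)
open import Data.Nat.GeneralisedArithmetic using (iterate)
open import Data.Parity using (Parity)
open import Data.Product using (∃-syntax; _×_; _,_; proj₁; proj₂)
open import Data.Product.Function.NonDependent.Propositional using (_×-↔_)
open import Data.Sum using (_⊎_; inj₁; inj₂)
open import Data.Sum.Function.Propositional using (_⊎-↔_)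
open import Data.Sum.Properties using (inj₁-injective; inj₂-injective)
open import Function using (_∘_; _↔_; Inverse; mk↔ₛ′)
open import Function.Construct.Composition using (_↔-∘_)
open import Function.Construct.Symmetry using (↔-sym)
open import Relation.Binary.PropositionalEquality
  using (_≡_; _≢_; refl; sym; trans; cong; setoid)
open import Relation.Nullary using (¬_; yes; no)
open import Relation.Nullary.Decidable using (Dec; does)

-- The two ends of an edge are labelled by Bool; the labelling is an
-- arbitrary auxiliary orientation.
record Graph : Set₁ where
  field
    V E : Set
    end : E → Bool → V

  -- A dart is an edge together with one of its ends.  At a vertex of a
  -- tree (which has no loops) the darts with that tail are the same thing
  -- as the incident edges.
  Dart : Set
  Dart = E × Bool

  edge : Dart → E
  edge = proj₁

  tail : Dart → V
  tail (e , b) = end e b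

  rev : Dart → Dart
  rev (e , b) = e , not b

  head : Dart → V
  head d = tail (rev d)

  IsWalk : V → List Dart → V → Set
  IsWalk u []       w = u ≡ w
  IsWalk u (d ∷ ds) w = tail d ≡ u × IsWalk (head d) ds w

  IsCycle : V → List Dart → Set
  IsCycle v ds =
    ds ≢ [] × IsWalk v ds v × Unique (map edge ds) × Unique (map tail ds)

record IsTree (G : Graph) : Set where
  open Graph G
  field
    nonempty  : V
    connected : ∀ u w → ∃[ ds ] IsWalk u ds w
    acyclic   : ∀ v ds → ¬ IsCycle v ds

record PlaneTree : Set₁ where
  field
    graph  : Graph
    isTree : IsTree graph
  open Graph graph public
  open IsTree isTree public
  field
    order size : ℕ
    finiteV    : V ↔ Fin order
    finiteE    : E ↔ Fin size
    -- The edge following a given one counterclockwise around a vertex.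
    rotation   : Dart ↔ Dart

  next : Dart → Dart
  next = Inverse.to rotation

  field
    next-tail   : ∀ d → tail (next d) ≡ tail d
    next-cyclic : ∀ d d′ → tail d ≡ tail d′ → ∃[ i ] iterate next d i ≡ d′

data PRTree : Set where
  node : List PRTree → PRTree

data Bracket : Set where
  opening closing : Bracket

code  : PRTree → List Bracket
codes : List PRTree → List Bracket
code (node ts) = opening ∷ codes ts ++ closing ∷ []
codes []       = []
codes (t ∷ ts) = code t ++ codes ts

openings : List Bracket → ℕ
openings []             = 0
openings (opening ∷ bs) = suc (openings bs)
openings (closing ∷ bs) = openings bs

inversions : List Bracket → ℕ
inversions []             = 0
inversions (opening ∷ bs) = inversions bs
inversions (closing ∷ bs) = openings bs + inversions bs

prParity : PRTree → Parity
prParity t = parity (inversions (code t))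

module _ (T : PlaneTree) where
  open PlaneTree T

  -- Sweep d₀ d ds: ds = d, next d, next (next d), … up to the last dart
  -- before the first return to d₀.
  data Sweep (d₀ : Dart) : Dart → List Dart → Set where
    stop : ∀ {d} → next d ≡ d₀ → Sweep d₀ d (d ∷ [])
    step : ∀ {d ds} → next d ≢ d₀ → Sweep d₀ (next d) ds → Sweep d₀ d (d ∷ ds)

  -- All edges at tail d, each once, counterclockwise starting from d.
  Around : Dart → List Dart → Set
  Around d = Sweep d d

  -- Hangs d t: t is the pr-subtree at the child head d of tail d.  Around
  -- the child, rev d is the edge to the parent.
  data Hangs : Dart → PRTree → Set where
    hangs : ∀ {d ds ts} → Around (rev d) (rev d ∷ ds) →
            Pointwise Hangs ds ts → Hangs d (node ts)

  -- RootedAt d t: t is the pr-tree obtained from T by choosing the root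
  -- tail d and the marked edge d.
  data RootedAt : Dart → PRTree → Set where
    rooted : ∀ {d ds ts} → Around d ds →
             Pointwise Hangs ds ts → RootedAt d (node ts)

  -- For trees of even order the parity does not depend on the choice of d,
  -- so that exactly one parity p satisfies HasParity p.
  HasParity : Parity → Set
  HasParity p = ∃[ d ] ∃[ t ] RootedAt d t × prParity t ≡ p

data Colour : Set where
  white black : Colour

_≟_ : (c c′ : Colour) → Dec (c ≡ c′)
white ≟ white = yes refl
white ≟ black = no λ ()
black ≟ white = no λ ()
black ≟ black = yes refl

record PlaneBipartiteTree : Set₁ where
  field
    planeTree : PlaneTree
  open PlaneTree planeTree public
  field
    colour : V → Colour
    proper : ∀ e → colour (end e false) ≢ colour (end e true)

  side : Colour → E → Bool
  side c e = if does (colour (end e false) ≟ c) then false else true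

  dartAt : Colour → E → Dart
  dartAt c e = e , side c e

  private
    pigeonhole : ∀ {a b c : Colour} → a ≢ b → a ≢ c → b ≡ c
    pigeonhole {white} {white} {_}     p q = ⊥-elim (p refl)
    pigeonhole {white} {black} {white} p q = ⊥-elim (q refl)
    pigeonhole {white} {black} {black} p q = refl
    pigeonhole {black} {black} {_}     p q = ⊥-elim (p refl)
    pigeonhole {black} {white} {black} p q = ⊥-elim (q refl)
    pigeonhole {black} {white} {white} p q = refl

    dartAt-colour : ∀ c e → colour (tail (dartAt c e)) ≡ c
    dartAt-colour c e with colour (end e false) ≟ c
    ... | yes p = p
    ... | no ¬p = pigeonhole (proper e) ¬p

    dartAt-unique : ∀ c d → colour (tail d) ≡ c → dartAt c (edge d) ≡ d
    dartAt-unique c (e , b) q with colour (end e false) ≟ c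
    dartAt-unique c (e , false) q | yes p = refl
    dartAt-unique c (e , true)  q | yes p = ⊥-elim (proper e (trans p (sym q)))
    dartAt-unique c (e , false) q | no ¬p = ⊥-elim (¬p q)
    dartAt-unique c (e , true)  q | no ¬p = refl

    prev : Dart → Dart
    prev = Inverse.from rotation

    next-prev : ∀ d → next (prev d) ≡ d
    next-prev d = Inverse.inverseˡ rotation refl

    prev-next : ∀ d → prev (next d) ≡ d
    prev-next d = Inverse.inverseʳ rotation refl

    prev-tail : ∀ d → tail (prev d) ≡ tail d
    prev-tail d = trans (sym (next-tail (prev d))) (cong tail (next-prev d))

    next-at : ∀ c e → dartAt c (edge (next (dartAt c e))) ≡ next (dartAt c e)
    next-at c e = dartAt-unique c _
      (trans (cong colour (next-tail (dartAt c e))) (dartAt-colour c e))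

    prev-at : ∀ c e → dartAt c (edge (prev (dartAt c e))) ≡ prev (dartAt c e)
    prev-at c e = dartAt-unique c _
      (trans (cong colour (prev-tail (dartAt c e))) (dartAt-colour c e))

  -- The edge following e counterclockwise around its end of colour c.
  turn : Colour → E ↔ E
  turn c = mk↔ₛ′
    (λ e → edge (next (dartAt c e)))
    (λ e → edge (prev (dartAt c e)))
    (λ e → cong edge (trans (cong next (prev-at c e)) (next-prev (dartAt c e))))
    (λ e → cong edge (trans (cong prev (next-at c e)) (prev-next (dartAt c e))))

  s : Colour → ∀ {m} → E ↔ Fin m → Permutation′ m
  s c enum = enum ↔-∘ (turn c ↔-∘ ↔-sym enum)

-- The subgroup of Sₘ generated by π and ρ.  Permutations are identified
-- when they agree pointwise, hence the last constructor.
data ⟨_,_⟩ {m} (π ρ : Permutation′ m) : Permutation′ m → Set where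
  gen₁    : ⟨ π , ρ ⟩ π
  gen₂    : ⟨ π , ρ ⟩ ρ
  unit    : ⟨ π , ρ ⟩ idₚ
  product : ∀ {σ τ} → ⟨ π , ρ ⟩ σ → ⟨ π , ρ ⟩ τ → ⟨ π , ρ ⟩ (σ ∘ₚ τ)
  inverse : ∀ {σ} → ⟨ π , ρ ⟩ σ → ⟨ π , ρ ⟩ (flip σ)
  resp    : ∀ {σ τ} → σ ≈ τ → ⟨ π , ρ ⟩ σ → ⟨ π , ρ ⟩ τ

rotationGroup : (T : PlaneBipartiteTree) → let open PlaneBipartiteTree T in
                ∀ {m} → E ↔ Fin m → Permutation′ m → Set
rotationGroup T enum = ⟨ s white enum , s black enum ⟩
  where open PlaneBipartiteTree T

-- Every edge e receives a new vertex inj₂ e; the edges of the subdivision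
-- are the darts of G, with end false at the old vertex and true at the new.
subdivide : Graph → Graph
subdivide G = record { V = V ⊎ E ; E = Dart ; end = end′ }
  where
  open Graph G
  end′ : Dart → Bool → V ⊎ E
  end′ d false = inj₁ (tail d)
  end′ d true  = inj₂ (edge d)

private
  module Subdivision (G : Graph) where
    open Graph G
    private module S = Graph (subdivide G)

    rev-unique : ∀ d d′ → edge d′ ≡ edge d → d ≢ d′ → d′ ≡ rev d
    rev-unique (e , false) (_ , false) refl p = ⊥-elim (p refl)
    rev-unique (e , false) (_ , true)  refl p = refl
    rev-unique (e , true)  (_ , false) refl p = refl
    rev-unique (e , true)  (_ , true)  refl p = ⊥-elim (p refl)

    expand : List Dart → List S.Dart
    expand []       = []
    expand (d ∷ ds) = (d , false) ∷ (rev d , true) ∷ expand ds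

    expand-walk : ∀ {u} ds {w} → IsWalk u ds w → S.IsWalk (inj₁ u) (expand ds) (inj₁ w)
    expand-walk []       refl        = refl
    expand-walk (d ∷ ds) (refl , wk) = refl , refl , expand-walk ds wk

    ++-walk : ∀ {u v w} as {bs} → S.IsWalk u as v → S.IsWalk v bs w →
              S.IsWalk u (as ++ bs) w
    ++-walk []       refl     q = q
    ++-walk (a ∷ as) (p , ps) q = p , ++-walk as ps q

    connected : (∀ u w → ∃[ ds ] IsWalk u ds w) → ∀ u w → ∃[ ds ] S.IsWalk u ds w
    connected conn u w with fromVertex u | toVertex w
      where
      fromVertex : ∀ u → ∃[ v ] ∃[ ds ] S.IsWalk u ds (inj₁ v)
      fromVertex (inj₁ v) = v , [] , refl
      fromVertex (inj₂ e) = end e false , ((e , false) , true) ∷ [] , refl , refl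
      toVertex : ∀ w → ∃[ v ] ∃[ ds ] S.IsWalk (inj₁ v) ds w
      toVertex (inj₁ v) = v , [] , refl
      toVertex (inj₂ e) = end e false , ((e , false) , false) ∷ [] , refl , refl
    ... | v , as , p | v′ , bs , q with conn v v′
    ... | ds , r = _ , ++-walk as p (++-walk (expand ds) (expand-walk ds r) q)

    contract : ∀ {u} ds {w} → S.IsWalk (inj₁ u) ds (inj₁ w) → Unique (map S.edge ds) →
               ∃[ cs ] ds ≡ expand cs × IsWalk u cs w
    contract [] p _ = [] , refl , inj₁-injective p
    contract ((d , true) ∷ ds) (() , _) _
    contract ((d , false) ∷ []) (_ , ()) _
    contract ((d , false) ∷ (d′ , false) ∷ ds) (_ , () , _) _
    contract ((d , false) ∷ (d′ , true) ∷ ds) (p , q , wk) ((d≢d′ ∷ _) ∷ (_ ∷ un))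
      with refl ← rev-unique d d′ (inj₂-injective q) d≢d′
      with cs , refl , wk′ ← contract ds wk un
      = d ∷ cs , refl , inj₁-injective p , wk′

    edges-fresh : ∀ {e} cs → All (inj₂ e ≢_) (map S.tail (expand cs)) →
                  All (e ≢_) (map edge cs)
    edges-fresh []       _            = []
    edges-fresh (c ∷ cs) (_ ∷ p ∷ ps) = (p ∘ cong inj₂) ∷ edges-fresh cs ps

    tails-fresh : ∀ {v} cs → All (inj₁ v ≢_) (map S.tail (expand cs)) →
                  All (v ≢_) (map tail cs)
    tails-fresh []       _            = []
    tails-fresh (c ∷ cs) (p ∷ _ ∷ ps) = (p ∘ cong inj₁) ∷ tails-fresh cs ps

    edges-unique : ∀ cs → Unique (map S.tail (expand cs)) → Unique (map edge cs)
    edges-unique []       _             = []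
    edges-unique (c ∷ cs) (_ ∷ p ∷ un)  = edges-fresh cs p ∷ edges-unique cs un

    tails-unique : ∀ cs → Unique (map S.tail (expand cs)) → Unique (map tail cs)
    tails-unique []       _                   = []
    tails-unique (c ∷ cs) ((_ ∷ p) ∷ _ ∷ un)  = tails-fresh cs p ∷ tails-unique cs un

    acyclic₁ : (∀ v ds → ¬ IsCycle v ds) → ∀ v ds → ¬ S.IsCycle (inj₁ v) ds
    acyclic₁ acyc v ds (ne , wk , ue , ut)
      with cs , refl , wk′ ← contract ds wk ue
      = acyc v cs ((ne ∘ cong expand) , wk′ , edges-unique cs ut , tails-unique cs ut)

    rotate-unique : ∀ {A : Set} (f : S.Dart → A) d ds →
                    Unique (map f (d ∷ ds)) → Unique (map f (ds ++ d ∷ []))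
    rotate-unique f d ds = Unique-resp-↭ (setoid _) (↭⇒↭ₛ (Perm.map⁺ f (Perm.∷↭∷ʳ d ds)))

    acyclic : (∀ v ds → ¬ IsCycle v ds) → ∀ v ds → ¬ S.IsCycle v ds
    acyclic acyc (inj₁ v) ds cyc = acyclic₁ acyc v ds cyc
    acyclic acyc (inj₂ e) [] (ne , _) = ne refl
    acyclic acyc (inj₂ e) ((d , false) ∷ ds) (_ , (() , _) , _)
    acyclic acyc (inj₂ e) ((d , true) ∷ ds) (_ , (p , wk) , ue , ut) =
      acyclic₁ acyc (tail d) (ds ++ (d , true) ∷ [])
        ( (λ eq → nonnil ds eq)
        , ++-walk ds wk (p , refl)
        , rotate-unique S.edge (d , true) ds ue
        , rotate-unique S.tail (d , true) ds ut)
      where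
      nonnil : ∀ ds {d : S.Dart} → ds ++ d ∷ [] ≢ []
      nonnil []      ()
      nonnil (_ ∷ _) ()

clean : PlaneTree → PlaneBipartiteTree
clean T = record
  { planeTree = record
    { graph       = subdivide graph
    ; isTree      = record
      { nonempty  = inj₁ nonempty
      ; connected = Subdivision.connected graph connected
      ; acyclic   = Subdivision.acyclic graph acyclic
      }
    ; order       = order + size
    ; size        = size * 2
    ; finiteV     = ↔-sym +↔⊎ ↔-∘ (finiteV ⊎-↔ finiteE)
    ; finiteE     = ↔-sym *↔× ↔-∘ (finiteE ×-↔ ↔-sym 2↔Bool)
    ; rotation    = mk↔ₛ′ next′ prev′ next-prev′ prev-next′
    ; next-tail   = next-tail′
    ; next-cyclic = next-cyclic′
    }
  ; colour = λ { (inj₁ _) → white ; (inj₂ _) → black }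
  ; proper = λ _ ()
  }
  where
  open PlaneTree T

  prev : Dart → Dart
  prev = Inverse.from rotation

  rev-rev : ∀ d → rev (rev d) ≡ d
  rev-rev (e , b) = cong (e ,_) (Bool.not-involutive b)

  -- At an old vertex the rotation is that of T; a new vertex has exactly
  -- two edges, which are interchanged.
  next′ prev′ : Dart × Bool → Dart × Bool
  next′ (d , false) = next d , false
  next′ (d , true)  = rev d , true
  prev′ (d , false) = prev d , false
  prev′ (d , true)  = rev d , true

  next-prev′ : ∀ x → next′ (prev′ x) ≡ x
  next-prev′ (d , false) = cong (_, false) (Inverse.inverseˡ rotation refl)
  next-prev′ (d , true)  = cong (_, true) (rev-rev d)

  prev-next′ : ∀ x → prev′ (next′ x) ≡ x
  prev-next′ (d , false) = cong (_, false) (Inverse.inverseʳ rotation refl)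
  prev-next′ (d , true)  = cong (_, true) (rev-rev d)

  open Graph (subdivide graph) using () renaming (tail to tail′)

  next-tail′ : ∀ x → tail′ (next′ x) ≡ tail′ x
  next-tail′ (d , false) = cong inj₁ (next-tail d)
  next-tail′ (d , true)  = refl

  iterate-old : ∀ d i → iterate next′ (d , false) i ≡ (iterate next d i , false)
  iterate-old d zero    = refl
  iterate-old d (suc i) = iterate-old (next d) i

  next-cyclic′ : ∀ x y → tail′ x ≡ tail′ y → ∃[ i ] iterate next′ x i ≡ y
  next-cyclic′ (d , false) (d′ , false) p with next-cyclic d d′ (inj₁-injective p)
  ... | i , q = i , trans (iterate-old d i) (cong (_, false) q)
  next-cyclic′ ((e , false) , true) ((_ , false) , true) refl = 0 , refl
  next-cyclic′ ((e , false) , true) ((_ , true)  , true) refl = 1 , refl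
  next-cyclic′ ((e , true)  , true) ((_ , false) , true) refl = 1 , refl
  next-cyclic′ ((e , true)  , true) ((_ , true)  , true) refl = 0 , refl

{-# OPTIONS --safe #-}
-- Put ρ for the rotation of the darts of a plane tree and α for their reversal;
-- these are the generators s_w and s_b of the rotation group of the clean tree.
-- Colour the vertices by the parity of their depth, and a dart as its tail.  Then
-- ρ preserves and α exchanges the two colour classes of darts.  For even n the
-- class sizes n − 1 are odd and both colours have equally many vertices mod 2, so
-- ρ has the same sign ε on both classes, one plus the number of vertices of
-- odd depth.  If ε = 0, every element of the group preserving the classes is even
-- on each of them, so ε is determined by the group and its classes.  The classes
-- in turn are determined by the group: ρ ∘ α, the walk around the tree, is a
-- cycle through all darts, hence alternates between the classes of any such colouring.
-- Finally the inversions of the bracket code are counted by the pairs of edges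
-- neither of which lies above the other, which gives (n choose 2) plus the number
-- of vertices of odd depth modulo 2.
module Submission where

open import Defs

open import Algebra.Bundles using (CommutativeSemigroup)
open import Algebra.Structures using (IsCommutativeMonoid)
open import Data.Bool using (if_then_else_)
open import Data.Bool.Properties using (not-involutive)
open import Data.Empty using (⊥-elim)
open import Data.Fin using (Fin; _<?_)
open import Data.Fin.Permutation
  using (Permutation′; _⟨$⟩ʳ_; _⟨$⟩ˡ_; _∘ₚ_; flip; inverseʳ)
import Data.Fin.Properties as Fin
open import Data.List
  using (List; []; _∷_; _++_; _∷ʳ_; map; foldr; concat; length; filter; allFin)
open import Data.List.Membership.Propositional using (_∈_; _∉_)
open import Data.List.Membership.Propositional.Properties
  using (∈-map⁺; ∈-map⁻; ∈-++⁻; ∈-filter⁺; ∈-filter⁻; ∈-allFin)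
open import Data.List.Membership.Propositional.Properties.WithK using (unique∧set⇒bag)
open import Data.List.Properties
  using (map-++; map-∘; map-cong; concat-++; concat-map; length-map; length-++; length-tabulate)
open import Data.List.Relation.Binary.BagAndSetEquality using (∼bag⇒↭)
open import Data.List.Relation.Binary.Permutation.Propositional
  using (_↭_; refl; prep; swap; trans; ↭-sym; ↭-trans; ↭-reflexive)
open import Data.List.Relation.Binary.Permutation.Propositional.Properties
  using (++⁺; shifts; ∷↭∷ʳ; ↭-length; ∈-resp-↭; map⁺)
open import Data.List.Relation.Binary.Pointwise using (Pointwise; []; _∷_)
open import Data.List.Relation.Unary.All as All using (All; []; _∷_)
import Data.List.Relation.Unary.All.Properties as All
open import Data.List.Relation.Unary.AllPairs using ([]; _∷_)
open import Data.List.Relation.Unary.Any using (here; there)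
open import Data.List.Relation.Unary.Unique.Propositional using (Unique)
import Data.List.Relation.Unary.Unique.Propositional.Properties as Unique
open import Data.Nat as ℕ using (ℕ; zero; suc; parity; _≤_; z≤n; s≤s; _∸_)
open import Data.Nat.Divisibility using (_∣_; divides)
open import Data.Nat.GeneralisedArithmetic using (iterate)
import Data.Nat.Properties as ℕ
open import Data.Nat.Solver using (module +-*-Solver)
open import Data.Parity using (Parity; 0ℙ; 1ℙ; _+_; _*_; _⁻¹)
import Data.Parity.Properties as ℙ
open import Data.Product using (∃-syntax; _×_; _,_; proj₂)
open import Data.Sum using (_⊎_; inj₁; inj₂)
open import Function using (_∘_; id; _↔_; Inverse; Injection; Injective; mk⇔)
open import Function.Construct.Symmetry using (↔-sym)
open import Function.Properties.Inverse using (↔⇒↣)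
open import Relation.Binary.Definitions using (DecidableEquality; tri<; tri≈; tri>)
open import Relation.Binary.PropositionalEquality as ≡
  using (_≡_; _≢_; cong; cong₂; subst; module ≡-Reasoning)
open import Relation.Nullary using (¬_; does; yes; no)
open import Relation.Nullary.Decidable using (dec-true; dec-false; via-injection)
open import Relation.Unary using (_≐_)
open ≡-Reasoning

-- Sums over lists in a commutative monoid.

module ListSum {A : Set} {_∙_ : A → A → A} {ε : A}
               (isCM : IsCommutativeMonoid _≡_ _∙_ ε) where
  open IsCommutativeMonoid isCM using (assoc; identityˡ; isCommutativeSemigroup)

  private
    commutativeSemigroup : CommutativeSemigroup _ _
    commutativeSemigroup = record { isCommutativeSemigroup = isCommutativeSemigroup }

  open import Algebra.Properties.CommutativeSemigroup commutativeSemigroup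
    using (x∙yz≈y∙xz) renaming (interchange to ∙-interchange)

  private variable
    X Y : Set
    xs ys : List X

  ∑ : (X → A) → List X → A
  ∑ f = foldr (λ x → f x ∙_) ε

  ∑-cong : {f g : X → A} → (∀ x → f x ≡ g x) → ∀ xs → ∑ f xs ≡ ∑ g xs
  ∑-cong p []       = ≡.refl
  ∑-cong p (x ∷ xs) = cong₂ _∙_ (p x) (∑-cong p xs)

  ∑-∙ : (f g : X → A) → ∀ xs → ∑ (λ x → f x ∙ g x) xs ≡ ∑ f xs ∙ ∑ g xs
  ∑-∙ f g []       = ≡.sym (identityˡ ε)
  ∑-∙ f g (x ∷ xs) = ≡.trans (cong (_ ∙_) (∑-∙ f g xs)) (∙-interchange _ _ _ _)

  ∑-map : (f : Y → A) (h : X → Y) → ∀ xs → ∑ f (map h xs) ≡ ∑ (f ∘ h) xs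
  ∑-map f h []       = ≡.refl
  ∑-map f h (x ∷ xs) = cong (_ ∙_) (∑-map f h xs)

  ∑-++ : (f : X → A) → ∀ xs ys → ∑ f (xs ++ ys) ≡ ∑ f xs ∙ ∑ f ys
  ∑-++ f []       ys = ≡.sym (identityˡ _)
  ∑-++ f (x ∷ xs) ys = ≡.trans (cong (_ ∙_) (∑-++ f xs ys)) (≡.sym (assoc _ _ _))

  ∑-↭ : (f : X → A) → xs ↭ ys → ∑ f xs ≡ ∑ f ys
  ∑-↭ f refl         = ≡.refl
  ∑-↭ f (prep x p)   = cong (_ ∙_) (∑-↭ f p)
  ∑-↭ f (swap x y p) = ≡.trans (x∙yz≈y∙xz _ _ _) (cong (λ a → _ ∙ (_ ∙ a)) (∑-↭ f p))
  ∑-↭ f (trans p q)  = ≡.trans (∑-↭ f p) (∑-↭ f q)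

  ∑-ε : (xs : List X) → ∑ (λ _ → ε) xs ≡ ε
  ∑-ε []       = ≡.refl
  ∑-ε (x ∷ xs) = ≡.trans (identityˡ _) (∑-ε xs)

  ∑-swap : (f : X → Y → A) → ∀ xs ys →
           ∑ (λ x → ∑ (f x) ys) xs ≡ ∑ (λ y → ∑ (λ x → f x y) xs) ys
  ∑-swap f []       ys = ≡.sym (∑-ε ys)
  ∑-swap f (x ∷ xs) ys =
    ≡.trans (cong (_ ∙_) (∑-swap f xs ys)) (≡.sym (∑-∙ (f x) _ ys))

open ListSum ℙ.+-0-isCommutativeMonoid

open import Algebra.Properties.CommutativeSemigroup ℙ.+-commutativeSemigroup
  using (interchange)

parity-suc : ∀ n → parity (suc n) ≡ 1ℙ + parity n
parity-suc n = ℙ.+-homo-+ 1 n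

+-cancel-twice : ∀ p q → (p + q) + q ≡ p
+-cancel-twice p q =
  ≡.trans (ℙ.+-assoc p q q) (≡.trans (cong (p +_) (ℙ.p+p≡0ℙ q)) (ℙ.+-identityʳ p))

+≡0⇒≡ : ∀ p q → p + q ≡ 0ℙ → p ≡ q
+≡0⇒≡ 0ℙ q  eq = ≡.sym eq
+≡0⇒≡ 1ℙ 1ℙ eq = ≡.refl

-- Sums modulo 2 over pairs of list entries.

module _ {X : Set} where

  private variable
    xs ys : List X

  pairs : (X → X → Parity) → List X → Parity
  pairs f []       = 0ℙ
  pairs f (x ∷ xs) = ∑ (f x) xs + pairs f xs

  cross : (X → X → Parity) → List X → List X → Parity
  cross f xs ys = ∑ (λ x → ∑ (f x) ys) xs

  pairs-cong : {f g : X → X → Parity} → (∀ x y → f x y ≡ g x y) →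
               ∀ xs → pairs f xs ≡ pairs g xs
  pairs-cong p []       = ≡.refl
  pairs-cong p (x ∷ xs) = cong₂ _+_ (∑-cong (p x) xs) (pairs-cong p xs)

  pairs-0 : ∀ xs → pairs (λ _ _ → 0ℙ) xs ≡ 0ℙ
  pairs-0 []       = ≡.refl
  pairs-0 (x ∷ xs) = cong₂ _+_ (∑-ε xs) (pairs-0 xs)

  pairs-+ : (f g : X → X → Parity) → ∀ xs →
            pairs (λ x y → f x y + g x y) xs ≡ pairs f xs + pairs g xs
  pairs-+ f g []       = ≡.refl
  pairs-+ f g (x ∷ xs) =
    ≡.trans (cong₂ _+_ (∑-∙ (f x) (g x) xs) (pairs-+ f g xs))
            (interchange (∑ (f x) xs) _ _ _)

  pairs-++ : (f : X → X → Parity) → ∀ xs ys →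
             pairs f (xs ++ ys) ≡ (pairs f xs + pairs f ys) + cross f xs ys
  pairs-++ f []       ys = ≡.sym (ℙ.+-identityʳ _)
  pairs-++ f (x ∷ xs) ys = begin
    ∑ (f x) (xs ++ ys) + pairs f (xs ++ ys)
      ≡⟨ cong₂ _+_ (∑-++ (f x) xs ys) (pairs-++ f xs ys) ⟩
    (a + b) + ((c + d) + e)
      ≡⟨ rearrange a b c d e ⟩
    ((a + c) + d) + (b + e) ∎
    where
    a = ∑ (f x) xs
    b = ∑ (f x) ys
    c = pairs f xs
    d = pairs f ys
    e = cross f xs ys
    rearrange : ∀ a b c d e → (a + b) + ((c + d) + e) ≡ ((a + c) + d) + (b + e)
    rearrange a b c d e = ≡.trans (interchange a b (c + d) e)
      (cong (_+ (b + e)) (≡.sym (ℙ.+-assoc a c d)))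

  -- Exchanging two neighbours `x` and `y` alters only the summand of this one pair, and symmetry
  -- restores it.
  pairs-↭ : {f : X → X → Parity} → (∀ x y → f x y ≡ f y x) →
            xs ↭ ys → pairs f xs ≡ pairs f ys
  pairs-↭ s refl         = ≡.refl
  pairs-↭ {f = f} s (prep x p) = cong₂ _+_ (∑-↭ (f x) p) (pairs-↭ s p)
  pairs-↭ {f = f} s (swap {xs} {ys} x y p) = begin
    (f x y + ∑ (f x) xs) + (∑ (f y) xs + pairs f xs)
      ≡⟨ interchange (f x y) _ _ _ ⟩
    (f x y + ∑ (f y) xs) + (∑ (f x) xs + pairs f xs)
      ≡⟨ cong₂ _+_ (cong₂ _+_ (s x y) (∑-↭ (f y) p))
                   (cong₂ _+_ (∑-↭ (f x) p) (pairs-↭ s p)) ⟩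
    (f y x + ∑ (f y) ys) + (∑ (f x) ys + pairs f ys) ∎
  pairs-↭ s (trans p q)  = ≡.trans (pairs-↭ s p) (pairs-↭ s q)

  cross-↭ : (f : X → X → Parity) {xs xs′ ys ys′ : List X} →
            xs ↭ xs′ → ys ↭ ys′ → cross f xs ys ≡ cross f xs′ ys′
  cross-↭ f {xs} {ys′ = ys′} p q =
    ≡.trans (∑-cong (λ x → ∑-↭ (f x) q) xs) (∑-↭ (λ x → ∑ (f x) ys′) p)

pairs-map : {X Y : Set} (f : Y → Y → Parity) (h : X → Y) → ∀ xs →
            pairs f (map h xs) ≡ pairs (λ x y → f (h x) (h y)) xs
pairs-map f h []       = ≡.refl
pairs-map f h (x ∷ xs) = cong₂ _+_ (∑-map (f (h x)) h xs) (pairs-map f h xs)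

-- Signs of permutations, computed on lists.

Tournament : {X : Set} → (X → X → Parity) → Set
Tournament r = ∀ {x y} → x ≢ y → r x y + r y x ≡ 1ℙ

-- If r is the comparison of a linear order and g permutes the elements of
-- xs, then sgn r g xs is the sign of that permutation.  Summing the symmetric
-- function [r x y] + [r (g x) (g y)] instead of the inversions makes the sum
-- independent of the order of xs, and multiplicativity a telescoping.
sgn : {X : Set} → (X → X → Parity) → (X → X) → List X → Parity
sgn r g = pairs (λ x y → r x y + r (g x) (g y))

module _ {X : Set} where

  -- The single equation of lists says that `g` takes each entry to the following one and the last
  -- back to the first. In this form the image of a cycle is its rotation by one place.
  Cyclic : (X → X) → List X → Set
  Cyclic g xs = ∃[ x ] ∃[ ys ] xs ≡ x ∷ ys × map g xs ≡ ys ∷ʳ x × Unique xs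

  cyclic-↭ : ∀ {g xs} → Cyclic g xs → map g xs ↭ xs
  cyclic-↭ (x , ys , ≡.refl , p , _) =
    ↭-trans (↭-reflexive p) (↭-sym (∷↭∷ʳ x ys))

  map-concat-↭ : ∀ {g xss} → All (Cyclic g) xss → map g (concat xss) ↭ concat xss
  map-concat-↭ [] = refl
  map-concat-↭ {g} {xs ∷ xss} (c ∷ cs) =
    ↭-trans (↭-reflexive (map-++ g xs (concat xss)))
            (++⁺ (cyclic-↭ c) (map-concat-↭ cs))

module _ {X : Set} (r : X → X → Parity) where

  sgn-cong : {g h : X → X} → (∀ x → g x ≡ h x) → ∀ xs → sgn r g xs ≡ sgn r h xs
  sgn-cong p = pairs-cong λ x y → cong (r x y +_) (cong₂ r (p x) (p y))

  sgn-id : ∀ xs → sgn r id xs ≡ 0ℙ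
  sgn-id xs = ≡.trans (pairs-cong (λ x y → ℙ.p+p≡0ℙ (r x y)) xs) (pairs-0 xs)

  sgn-∘ : ∀ h g xs → sgn r (h ∘ g) xs ≡ sgn r g xs + sgn r h (map g xs)
  sgn-∘ h g xs = begin
    sgn r (h ∘ g) xs
      ≡⟨ pairs-cong (λ x y → telescope (r x y) (r (g x) (g y)) _) xs ⟩
    pairs (λ x y → (r x y + r (g x) (g y)) + (r (g x) (g y) + r (h (g x)) (h (g y)))) xs
      ≡⟨ pairs-+ _ _ xs ⟩
    sgn r g xs + pairs (λ x y → r (g x) (g y) + r (h (g x)) (h (g y))) xs
      ≡⟨ cong (sgn r g xs +_) (pairs-map _ g xs) ⟨
    sgn r g xs + sgn r h (map g xs) ∎
    where
    telescope : ∀ a b c → a + c ≡ (a + b) + (b + c)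
    telescope 0ℙ 0ℙ c = ≡.refl
    telescope 0ℙ 1ℙ c = ≡.sym (ℙ.⁻¹-involutive c)
    telescope 1ℙ 0ℙ c = ≡.refl
    telescope 1ℙ 1ℙ c = ≡.refl

  -- Separates the sign into a count on the list and one on its image, for the cases in which the
  -- image is known explicitly as a list.
  sgn-split : ∀ g xs → sgn r g xs ≡ pairs r xs + pairs r (map g xs)
  sgn-split g xs = ≡.trans (pairs-+ r _ xs) (cong (pairs r xs +_) (≡.sym (pairs-map r g xs)))

  module _ (tournament : Tournament r) where

    -- For `x ≢ y` injectivity keeps `g x` and `g y` distinct, so exchanging `x` and `y` flips both
    -- terms of the summand and leaves it unchanged.
    sgn-↭ : DecidableEquality X → ∀ {g} → Injective _≡_ _≡_ g →
            ∀ {xs ys} → xs ↭ ys → sgn r g xs ≡ sgn r g ys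
    sgn-↭ _≟_ {g} inj = pairs-↭ symmetric
      where
      both-flip : ∀ a b c d → a + b ≡ 1ℙ → c + d ≡ 1ℙ → a + c ≡ b + d
      both-flip 0ℙ b 0ℙ d ≡.refl ≡.refl = ≡.refl
      both-flip 0ℙ b 1ℙ 0ℙ ≡.refl _ = ≡.refl
      both-flip 1ℙ 0ℙ 0ℙ d _ ≡.refl = ≡.refl
      both-flip 1ℙ 0ℙ 1ℙ 0ℙ _ _ = ≡.refl
      symmetric : ∀ x y → r x y + r (g x) (g y) ≡ r y x + r (g y) (g x)
      symmetric x y with x ≟ y
      ... | yes ≡.refl = ≡.refl
      ... | no x≢y = both-flip (r x y) _ _ _ (tournament x≢y) (tournament (x≢y ∘ inj))

    private
      -- Moving `x` from the front of the list to its end reverses its comparison with every entry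
      -- of `ys`, one flip for each.
      ∑-flip : ∀ {x ys} → All (x ≢_) ys →
               ∑ (r x) ys + ∑ (λ y → ∑ (r y) (x ∷ [])) ys ≡ parity (length ys)
      ∑-flip [] = ≡.refl
      ∑-flip {x} {y ∷ ys} (x≢y ∷ fresh) = begin
        (r x y + ∑ (r x) ys) + ((r y x + 0ℙ) + _)
          ≡⟨ cong (λ a → (r x y + ∑ (r x) ys) + (a + _)) (ℙ.+-identityʳ (r y x)) ⟩
        (r x y + ∑ (r x) ys) + (r y x + _)
          ≡⟨ interchange (r x y) _ (r y x) _ ⟩
        (r x y + r y x) + (∑ (r x) ys + _)
          ≡⟨ cong₂ _+_ (tournament x≢y) (∑-flip fresh) ⟩
        1ℙ + parity (length ys)
          ≡⟨ parity-suc (length ys) ⟨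
        parity (suc (length ys)) ∎

    -- Rotating the list leaves the comparisons within `ys` as they were, so they cancel; the first
    -- entry passes all the others.
    sgn-cyclic : ∀ {g xs} → Cyclic g xs → sgn r g xs ≡ parity (length xs) + 1ℙ
    sgn-cyclic {g} (x , ys , ≡.refl , p , fresh ∷ _) = begin
      sgn r g (x ∷ ys)
        ≡⟨ sgn-split g (x ∷ ys) ⟩
      (a + b) + pairs r (map g (x ∷ ys))
        ≡⟨ cong (λ zs → (a + b) + pairs r zs) p ⟩
      (a + b) + pairs r (ys ∷ʳ x)
        ≡⟨ cong ((a + b) +_) (pairs-++ r ys (x ∷ [])) ⟩
      (a + b) + ((b + 0ℙ) + c)
        ≡⟨ cancel a b c ⟩
      a + c
        ≡⟨ ∑-flip fresh ⟩
      parity (length ys)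
        ≡⟨ ℙ.suc-homo-⁻¹ (length ys) ⟨
      1ℙ + parity (suc (length ys))
        ≡⟨ ℙ.+-comm 1ℙ (parity (suc (length ys))) ⟩
      parity (suc (length ys)) + 1ℙ ∎
      where
      a = ∑ (r x) ys
      b = pairs r ys
      c = cross r ys (x ∷ [])
      cancel : ∀ a b c → (a + b) + ((b + 0ℙ) + c) ≡ a + c
      cancel 0ℙ 0ℙ c = ≡.refl
      cancel 0ℙ 1ℙ c = ℙ.⁻¹-involutive c
      cancel 1ℙ 0ℙ c = ≡.refl
      cancel 1ℙ 1ℙ c = ≡.refl

    -- Comparisons between different blocks cancel: `g` permutes each block within itself, so the
    -- cross sums before and after are equal. What remains is the usual formula, number of points
    -- minus number of cycles.
    sgn-cycles : ∀ {g xss} → All (Cyclic g) xss →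
                 sgn r g (concat xss) ≡ parity (length (concat xss)) + parity (length xss)
    sgn-cycles [] = ≡.refl
    sgn-cycles {g} {xs ∷ xss} (c ∷ cs) = begin
      sgn r g (xs ++ ys)
        ≡⟨ sgn-split g (xs ++ ys) ⟩
      pairs r (xs ++ ys) + pairs r (map g (xs ++ ys))
        ≡⟨ cong₂ _+_ (pairs-++ r xs ys)
             (≡.trans (cong (pairs r) (map-++ g xs ys)) (pairs-++ r (map g xs) (map g ys))) ⟩
      ((pairs r xs + pairs r ys) + cross r xs ys) +
      ((pairs r (map g xs) + pairs r (map g ys)) + cross r (map g xs) (map g ys))
        ≡⟨ cong (λ z → ((pairs r xs + pairs r ys) + cross r xs ys) +
                     ((pairs r (map g xs) + pairs r (map g ys)) + z))
             (cross-↭ r (cyclic-↭ c) (map-concat-↭ cs)) ⟩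
      ((pairs r xs + pairs r ys) + cross r xs ys) +
      ((pairs r (map g xs) + pairs r (map g ys)) + cross r xs ys)
        ≡⟨ cancel (pairs r xs) (pairs r ys) (cross r xs ys) (pairs r (map g xs)) _ ⟩
      (pairs r xs + pairs r (map g xs)) + (pairs r ys + pairs r (map g ys))
        ≡⟨ cong₂ _+_ (sgn-split g xs) (sgn-split g ys) ⟨
      sgn r g xs + sgn r g ys
        ≡⟨ cong₂ _+_ (sgn-cyclic c) (sgn-cycles cs) ⟩
      (parity (length xs) + 1ℙ) + (parity (length ys) + parity (length xss))
        ≡⟨ interchange (parity (length xs)) 1ℙ _ _ ⟩
      (parity (length xs) + parity (length ys)) + (1ℙ + parity (length xss))
        ≡⟨ cong₂ _+_ (ℙ.+-homo-+ (length xs) (length ys)) (parity-suc (length xss)) ⟨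
      parity (length xs ℕ.+ length ys) + parity (suc (length xss))
        ≡⟨ cong (λ k → parity k + parity (suc (length xss))) (length-++ xs) ⟨
      parity (length (xs ++ ys)) + parity (suc (length xss)) ∎
      where
      ys = concat xss
      cancel : ∀ a b c d e → ((a + b) + c) + ((d + e) + c) ≡ (a + d) + (b + e)
      cancel a b c d e = ≡.trans (interchange (a + b) c (d + e) c)
        (≡.trans (cong (((a + b) + (d + e)) +_) (ℙ.p+p≡0ℙ c))
        (≡.trans (ℙ.+-identityʳ _) (interchange a b d e)))

-- Signs on the colour classes

unique∧set⇒↭ : {X : Set} {xs ys : List X} → Unique xs → Unique ys →
               (∀ {x} → x ∈ xs → x ∈ ys) → (∀ {x} → x ∈ ys → x ∈ xs) → xs ↭ ys
unique∧set⇒↭ u v p q = ∼bag⇒↭ (unique∧set⇒bag u v (mk⇔ p q))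

less : ∀ {m} → Fin m → Fin m → Parity
less x y = if does (x <? y) then 1ℙ else 0ℙ

less-tournament : ∀ {m} → Tournament (less {m})
less-tournament {x = x} {y} x≢y with Fin.<-cmp x y
... | tri≈ _ x≡y _ = ⊥-elim (x≢y x≡y)
... | tri< x<y _ y≮x = cong₂ (λ a b → (if a then 1ℙ else 0ℙ) + (if b then 1ℙ else 0ℙ))
                         (dec-true (x <? y) x<y) (dec-false (y <? x) y≮x)
... | tri> x≮y _ y<x = cong₂ (λ a b → (if a then 1ℙ else 0ℙ) + (if b then 1ℙ else 0ℙ))
                         (dec-false (x <? y) x≮y) (dec-true (y <? x) y<x)

module _ {m : ℕ} where

  ⟨$⟩ʳ-injective : (g : Permutation′ m) → Injective _≡_ _≡_ (g ⟨$⟩ʳ_)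
  ⟨$⟩ʳ-injective g = Injection.injective (↔⇒↣ g)

  sgnₚ : Permutation′ m → List (Fin m) → Parity
  sgnₚ g = sgn less (g ⟨$⟩ʳ_)

  sgnₚ-↭ : ∀ g {xs ys} → xs ↭ ys → sgnₚ g xs ≡ sgnₚ g ys
  sgnₚ-↭ g = sgn-↭ less less-tournament Fin._≟_ (⟨$⟩ʳ-injective g)

  module _ (κ : Fin m → Parity) where

    class : Parity → List (Fin m)
    class b = filter (λ x → κ x ℙ.≟ b) (allFin m)

    ∈-class⁺ : ∀ {b x} → κ x ≡ b → x ∈ class b
    ∈-class⁺ = ∈-filter⁺ (λ x → κ x ℙ.≟ _) (∈-allFin _)

    ∈-class⁻ : ∀ {b x} → x ∈ class b → κ x ≡ b
    ∈-class⁻ p = proj₂ (∈-filter⁻ (λ x → κ x ℙ.≟ _) {xs = allFin m} p)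

    class-unique : ∀ b → Unique (class b)
    class-unique b = Unique.filter⁺ _ (Unique.allFin⁺ m)

    -- The two cases are `σ = 0ℙ`, where `g` preserves both classes, and `σ = 1ℙ`, where it
    -- exchanges them.
    Shifts : Permutation′ m → Parity → Set
    Shifts g σ = ∀ x → κ (g ⟨$⟩ʳ x) ≡ κ x + σ

    shifts-flip : ∀ {g σ} → Shifts g σ → Shifts (flip g) σ
    shifts-flip {g} {σ} sh x = begin
      κ y               ≡⟨ +-cancel-twice (κ y) σ ⟨
      (κ y + σ) + σ     ≡⟨ cong (_+ σ) (sh y) ⟨
      κ (g ⟨$⟩ʳ y) + σ  ≡⟨ cong (λ z → κ z + σ) (inverseʳ g) ⟩
      κ x + σ           ∎
      where
      y : Fin m
      y = g ⟨$⟩ˡ x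

    map-class : ∀ {g σ} → Shifts g σ → ∀ b → map (g ⟨$⟩ʳ_) (class b) ↭ class (b + σ)
    map-class {g} {σ} sh b =
      unique∧set⇒↭ (Unique.map⁺ (⟨$⟩ʳ-injective g) (class-unique b)) (class-unique (b + σ))
        (λ p → let x , q , eq = ∈-map⁻ (g ⟨$⟩ʳ_) p in ∈-class⁺
          (≡.trans (cong κ eq) (≡.trans (sh x) (cong (_+ σ) (∈-class⁻ q)))))
        (λ {x} p → subst (_∈ _) (inverseʳ g) (∈-map⁺ (g ⟨$⟩ʳ_) (∈-class⁺
          (≡.trans (shifts-flip {g} sh x)
          (≡.trans (cong (_+ σ) (∈-class⁻ p)) (+-cancel-twice b σ))))))

    -- In `g ∘ₚ h` the permutation `g` acts first, so `h` is evaluated on the class to which `g`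
    -- carries the given one.
    sgnₚ-∘ₚ : ∀ {g σ} h → Shifts g σ → ∀ b →
              sgnₚ (g ∘ₚ h) (class b) ≡ sgnₚ g (class b) + sgnₚ h (class (b + σ))
    sgnₚ-∘ₚ {g} h sh b = ≡.trans (sgn-∘ less (h ⟨$⟩ʳ_) (g ⟨$⟩ʳ_) (class b))
      (cong (sgnₚ g (class b) +_) (sgnₚ-↭ h (map-class {g} sh b)))

  class-cong : {κ κ′ : Fin m → Parity} (τ : Parity) → (∀ x → κ x ≡ κ′ x + τ) →
               ∀ b → class κ b ↭ class κ′ (b + τ)
  class-cong {κ} {κ′} τ p b =
    unique∧set⇒↭ (class-unique κ b) (class-unique κ′ (b + τ))
      (λ {x} q → ∈-class⁺ κ′ (≡.sym (move (≡.trans (≡.sym (p x)) (∈-class⁻ κ q)))))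
      (λ {x} q → ∈-class⁺ κ (≡.trans (p x) (move (≡.sym (∈-class⁻ κ′ q)))))
    where
    move : ∀ {c d} → c + τ ≡ d → d + τ ≡ c
    move {c} ≡.refl = +-cancel-twice c τ

  -- Collects what the comparison of two groups uses of a plane tree, with `ρ` and `α` the two
  -- generators, `κ` the colouring of the darts and `e` the common sign of `ρ` on the two classes.
  record Bicoloured (ρ α : Permutation′ m) (e : Parity) : Set where
    field
      point        : Fin m
      κ            : Fin m → Parity
      κ-ρ          : ∀ x → κ (ρ ⟨$⟩ʳ x) ≡ κ x
      κ-α          : ∀ x → κ (α ⟨$⟩ʳ x) ≡ κ x + 1ℙ
      α-involutive : ∀ x → α ⟨$⟩ʳ (α ⟨$⟩ʳ x) ≡ x
      -- ρ ∘ α is transitive.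
      cyclic       : (f : Fin m → Parity) → (∀ x → f (ρ ⟨$⟩ʳ (α ⟨$⟩ʳ x)) ≡ f x) →
                     ∀ x y → f x ≡ f y
      sign         : ∀ b → sgnₚ ρ (class κ b) ≡ e

  module _ {ρ α : Permutation′ m} {e : Parity} (B : Bicoloured ρ α e) where
    open Bicoloured B

    -- The case `σ = 0ℙ` is the aim: elements preserving the classes are even on each. The case
    -- `σ = 1ℙ`, to which `α` belongs, makes the condition pass to products.
    Even : Parity → Permutation′ m → Set
    Even a g = ∃[ σ ] Shifts κ g σ × (∀ b → sgnₚ g (class κ b) ≡ σ * a)

    private
      a : Parity
      a = sgnₚ α (class κ 0ℙ)

    -- `α` maps each class bijectively to the other and is its own inverse, so its signs in the two
    -- directions add up to that of the identity.
    sign-α : ∀ b → sgnₚ α (class κ b) ≡ a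
    sign-α 0ℙ = ≡.refl
    sign-α 1ℙ = ≡.sym (+≡0⇒≡ _ _ (begin
      a + sgnₚ α (class κ 1ℙ)
        ≡⟨ sgnₚ-∘ₚ κ {α} α κ-α 0ℙ ⟨
      sgnₚ (α ∘ₚ α) (class κ 0ℙ)
        ≡⟨ sgn-cong less α-involutive (class κ 0ℙ) ⟩
      sgn less id (class κ 0ℙ)
        ≡⟨ sgn-id less (class κ 0ℙ) ⟩
      0ℙ ∎))

    -- Induction on words in the generators. Shifts and signs both add along a product, because the
    -- second factor has the same sign on whichever class the first one leads to. The hypothesis on
    -- `e` is the case of `ρ`.
    even : e ≡ 0ℙ → ∀ {g} → ⟨ ρ , α ⟩ g → Even a g
    even p gen₁ = 0ℙ , (λ x → ≡.trans (κ-ρ x) (≡.sym (ℙ.+-identityʳ _))) ,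
                  λ b → ≡.trans (sign b) p
    even p gen₂ = 1ℙ , κ-α , sign-α
    even p unit = 0ℙ , (λ x → ≡.sym (ℙ.+-identityʳ _)) , λ b → sgn-id less (class κ b)
    even p (product {g} {h} u v) with even p u | even p v
    ... | σ , sh , q | τ , sh′ , q′ = σ + τ ,
      (λ x → ≡.trans (sh′ _) (≡.trans (cong (_+ τ) (sh x)) (ℙ.+-assoc (κ x) σ τ))) ,
      λ b → ≡.trans (sgnₚ-∘ₚ κ {g} h sh b)
        (≡.trans (cong₂ _+_ (q b) (q′ (b + σ))) (≡.sym (ℙ.*-distribʳ-+ a σ τ)))
    even p (inverse {g} u) with even p u
    ... | σ , sh , q = σ , shifts-flip κ {g} sh , λ b → +≡0⇒≡ _ _ (begin
      sgnₚ (flip g) (class κ b) + (σ * a)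
        ≡⟨ cong (sgnₚ (flip g) (class κ b) +_) (q (b + σ)) ⟨
      sgnₚ (flip g) (class κ b) + sgnₚ g (class κ (b + σ))
        ≡⟨ sgnₚ-∘ₚ κ {flip g} g (shifts-flip κ {g} sh) b ⟨
      sgnₚ (flip g ∘ₚ g) (class κ b)
        ≡⟨ sgn-cong less (λ x → inverseʳ g) (class κ b) ⟩
      sgn less id (class κ b)
        ≡⟨ sgn-id less (class κ b) ⟩
      0ℙ ∎)
    even p (resp {g} {h} g≈h u) with even p u
    ... | σ , sh , q = σ , (λ x → ≡.trans (cong κ (≡.sym (g≈h x))) (sh x)) ,
      λ b → ≡.trans (sgn-cong less (≡.sym ∘ g≈h) (class κ b)) (q b)

  private
    constant⇒shift : (κ κ′ : Fin m → Parity) → (∀ x y → κ x + κ′ x ≡ κ y + κ′ y) →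
                     ∀ x y → κ x ≡ κ′ x + (κ y + κ′ y)
    constant⇒shift κ κ′ p x y =
      ≡.trans (solve (κ x) (κ′ x)) (cong (κ′ x +_) (p x y))
      where
      solve : ∀ a b → a ≡ b + (a + b)
      solve 0ℙ b = ≡.sym (ℙ.p+p≡0ℙ b)
      solve 1ℙ 0ℙ = ≡.refl
      solve 1ℙ 1ℙ = ≡.refl

  -- The cycle ρ ∘ α lies in both groups, so it changes both colourings
  -- everywhere; hence they agree up to exchanging the colours, and ρ fixes
  -- the colour classes of the larger group.
  even-⊆ : ∀ {ρ α e ρ′ α′} → Bicoloured ρ α e → Bicoloured ρ′ α′ 0ℙ →
           (∀ {g} → ⟨ ρ , α ⟩ g → ⟨ ρ′ , α′ ⟩ g) → e ≡ 0ℙ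
  even-⊆ {ρ} {α} {e} {ρ′} {α′} B B′ incl = begin
    e
      ≡⟨ B.sign 0ℙ ⟨
    sgnₚ ρ (class B.κ 0ℙ)
      -- The colourings differ by a constant, read off at `B.point`, so a class of the first is one
      -- of the two classes of the second; `ρ-even` covers both.
      ≡⟨ sgnₚ-↭ ρ (class-cong _ (λ x → constant⇒shift B.κ B′.κ agree x B.point) 0ℙ) ⟩
    sgnₚ ρ (class B′.κ _)
      ≡⟨ ρ-even ⟩
    0ℙ ∎
    where
    module B  = Bicoloured B
    module B′ = Bicoloured B′

    c : Permutation′ m
    c = α ∘ₚ ρ

    κ-c : ∀ x → B.κ (c ⟨$⟩ʳ x) ≡ B.κ x + 1ℙ
    κ-c x = ≡.trans (B.κ-ρ _) (B.κ-α x)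

    alternates : ∀ σ → Shifts B′.κ c σ → Shifts B′.κ c 1ℙ
    alternates 1ℙ sh = sh
    -- A colouring preserved by `c` would be constant, as `c` is transitive, whereas `α′` changes
    -- it.
    alternates 0ℙ sh = ⊥-elim (p≢p+1 (≡.trans
      (B.cyclic B′.κ (λ x → ≡.trans (sh x) (ℙ.+-identityʳ _)) B.point (α′ ⟨$⟩ʳ B.point))
      (B′.κ-α B.point)))
      where
      p≢p+1 : ∀ {p} → p ≢ p + 1ℙ
      p≢p+1 {0ℙ} ()
      p≢p+1 {1ℙ} ()

    κ′-c : Shifts B′.κ c 1ℙ
    κ′-c with even B′ ≡.refl (incl (product gen₂ gen₁))
    ... | σ , sh , _ = alternates σ sh

    agree : ∀ x y → B.κ x + B′.κ x ≡ B.κ y + B′.κ y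
    agree = B.cyclic (λ x → B.κ x + B′.κ x)
      λ x → ≡.trans (cong₂ _+_ (κ-c x) (κ′-c x)) (both (B.κ x) (B′.κ x))
      where
      both : ∀ p q → (p + 1ℙ) + (q + 1ℙ) ≡ p + q
      both 0ℙ 0ℙ = ≡.refl
      both 0ℙ 1ℙ = ≡.refl
      both 1ℙ 0ℙ = ≡.refl
      both 1ℙ 1ℙ = ≡.refl

    ρ-even : ∀ {b} → sgnₚ ρ (class B′.κ b) ≡ 0ℙ
    ρ-even {b} with even B′ ≡.refl (incl gen₁)
    ... | σ , sh , q = ≡.trans (q b) (cong (_* _) (σ≡0 σ sh))
      where
      -- `ρ` preserves the first colouring, hence also the second, which differs from it by a
      -- constant.
      σ≡0 : ∀ σ → Shifts B′.κ ρ σ → σ ≡ 0ℙ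
      σ≡0 σ sh = ℙ.+-cancelˡ-≡ (B′.κ B.point) σ 0ℙ (begin
        B′.κ B.point + σ
          ≡⟨ sh B.point ⟨
        B′.κ (ρ ⟨$⟩ʳ B.point)
          ≡⟨ ℙ.+-cancelˡ-≡ (B.κ B.point) _ _ (≡.trans (cong (_+ _) (≡.sym (B.κ-ρ B.point)))
               (agree (ρ ⟨$⟩ʳ B.point) B.point)) ⟩
        B′.κ B.point
          ≡⟨ ℙ.+-identityʳ _ ⟨
        B′.κ B.point + 0ℙ ∎)

-- Inversions of bracket codes

nodeCount  : PRTree → ℕ
nodeCount* : List PRTree → ℕ
nodeCount (node ts)   = suc (nodeCount* ts)
nodeCount* []         = 0
nodeCount* (t ∷ ts)   = nodeCount t ℕ.+ nodeCount* ts

-- The number of vertices whose depth has the given parity.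
level  : Parity → PRTree → ℕ
level* : Parity → List PRTree → ℕ
level 0ℙ (node ts) = suc (level* 1ℙ ts)
level 1ℙ (node ts) = level* 0ℙ ts
level* b []        = 0
level* b (t ∷ ts)  = level b t ℕ.+ level* b ts

open import Algebra.Properties.CommutativeSemigroup ℕ.+-commutativeSemigroup
  using () renaming (interchange to ℕ-interchange)

nodeCount-level  : ∀ t → nodeCount t ≡ level 0ℙ t ℕ.+ level 1ℙ t
nodeCount*-level* : ∀ ts → nodeCount* ts ≡ level* 0ℙ ts ℕ.+ level* 1ℙ ts
nodeCount-level (node ts) = cong suc (≡.trans (nodeCount*-level* ts) (ℕ.+-comm (level* 0ℙ ts) _))
nodeCount*-level* []       = ≡.refl
nodeCount*-level* (t ∷ ts) = ≡.trans (cong₂ ℕ._+_ (nodeCount-level t) (nodeCount*-level* ts))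
  (ℕ-interchange (level 0ℙ t) _ _ _)

closings : List Bracket → ℕ
closings []             = 0
closings (opening ∷ bs) = closings bs
closings (closing ∷ bs) = suc (closings bs)

openings-++ : ∀ bs cs → openings (bs ++ cs) ≡ openings bs ℕ.+ openings cs
openings-++ []             cs = ≡.refl
openings-++ (opening ∷ bs) cs = cong suc (openings-++ bs cs)
openings-++ (closing ∷ bs) cs = openings-++ bs cs

closings-++ : ∀ bs cs → closings (bs ++ cs) ≡ closings bs ℕ.+ closings cs
closings-++ []             cs = ≡.refl
closings-++ (opening ∷ bs) cs = closings-++ bs cs
closings-++ (closing ∷ bs) cs = cong suc (closings-++ bs cs)

-- The product counts the inversions between the two words: every closing bracket of the first
-- precedes every opening bracket of the second.
inversions-++ : ∀ bs cs → inversions (bs ++ cs) ≡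
                inversions bs ℕ.+ inversions cs ℕ.+ closings bs ℕ.* openings cs
inversions-++ []             cs = ≡.sym (ℕ.+-identityʳ _)
inversions-++ (opening ∷ bs) cs = inversions-++ bs cs
inversions-++ (closing ∷ bs) cs =
  ≡.trans (cong₂ ℕ._+_ (openings-++ bs cs) (inversions-++ bs cs))
    (solve 5 (λ o o′ i i′ k → (o :+ o′) :+ ((i :+ i′) :+ k) :=
                              ((o :+ i) :+ i′) :+ (o′ :+ k))
      ≡.refl (openings bs) (openings cs) (inversions bs) (inversions cs) _)
  where open +-*-Solver

openings-code  : ∀ t → openings (code t) ≡ nodeCount t
openings-codes : ∀ ts → openings (codes ts) ≡ nodeCount* ts
openings-code (node ts) = cong suc (≡.trans (openings-++ (codes ts) _)
  (≡.trans (ℕ.+-identityʳ _) (openings-codes ts)))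
openings-codes []       = ≡.refl
openings-codes (t ∷ ts) = ≡.trans (openings-++ (code t) _)
  (cong₂ ℕ._+_ (openings-code t) (openings-codes ts))

closings-code  : ∀ t → closings (code t) ≡ nodeCount t
closings-codes : ∀ ts → closings (codes ts) ≡ nodeCount* ts
closings-code (node ts) = ≡.trans (closings-++ (codes ts) _)
  (≡.trans (ℕ.+-comm _ 1) (cong suc (closings-codes ts)))
closings-codes []       = ≡.refl
closings-codes (t ∷ ts) = ≡.trans (closings-++ (code t) _)
  (cong₂ ℕ._+_ (closings-code t) (closings-codes ts))

-- The binomial coefficient `n` choose 2 modulo 2, as the sum of the numbers below `n`.
choose₂ : ℕ → Parity
choose₂ zero    = 0ℙ
choose₂ (suc n) = choose₂ n + parity n

-- A pair from a disjoint union lies in the first part, in the second, or has one element in each.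
choose₂-+ : ∀ m n → choose₂ (m ℕ.+ n) ≡
            (choose₂ m + choose₂ n) + (parity m * parity n)
choose₂-+ zero    n = ≡.sym (ℙ.+-identityʳ _)
choose₂-+ (suc m) n = begin
  choose₂ (m ℕ.+ n) + parity (m ℕ.+ n)
    ≡⟨ cong₂ _+_ (choose₂-+ m n) (ℙ.+-homo-+ m n) ⟩
  ((choose₂ m + choose₂ n) + (p * q)) + (p + q)
    ≡⟨ solve (choose₂ m) (choose₂ n) p q ⟩
  ((choose₂ m + p) + choose₂ n) + ((1ℙ + p) * q)
    ≡⟨ cong (λ a → ((choose₂ m + p) + choose₂ n) + (a * q)) (ℙ.+-homo-+ 1 m) ⟨
  ((choose₂ m + p) + choose₂ n) + (parity (suc m) * q) ∎
  where
  p = parity m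
  q = parity n
  solve : ∀ a b p q → ((a + b) + (p * q)) + (p + q) ≡ ((a + p) + b) + ((1ℙ + p) * q)
  solve a b 0ℙ q = cong (_+ q) (≡.trans (ℙ.+-identityʳ _) (cong (_+ b) (≡.sym (ℙ.+-identityʳ a))))
  solve a b 1ℙ q = begin
    ((a + b) + q) + (1ℙ + q) ≡⟨ interchange (a + b) q 1ℙ q ⟩
    ((a + b) + 1ℙ) + (q + q) ≡⟨ cong₂ _+_ (≡.trans (ℙ.+-assoc a b 1ℙ)
        (≡.trans (cong (a +_) (ℙ.+-comm b 1ℙ)) (≡.sym (ℙ.+-assoc a 1ℙ b)))) (ℙ.p+p≡0ℙ q) ⟩
    ((a + 1ℙ) + b) + 0ℙ ∎

-- Two edges contribute one inversion if neither lies above the other and none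
-- otherwise; an edge whose lower vertex has depth k has k − 1 edges above it.
parity-code  : ∀ t → prParity t ≡ choose₂ (nodeCount t) + parity (level 1ℙ t)
parity-codes : ∀ ts → parity (inversions (codes ts)) ≡
               choose₂ (nodeCount* ts) + parity (level* 1ℙ ts)
parity-code (node ts) = begin
  parity (inversions (codes ts ++ closing ∷ []))
    ≡⟨ cong parity (≡.trans (inversions-++ (codes ts) _)
         (cong₂ ℕ._+_ (ℕ.+-identityʳ (inversions (codes ts))) (ℕ.*-zeroʳ (closings (codes ts))))) ⟩
  parity (inversions (codes ts) ℕ.+ 0)
    ≡⟨ cong parity (ℕ.+-identityʳ (inversions (codes ts))) ⟩
  parity (inversions (codes ts))
    ≡⟨ parity-codes ts ⟩
  choose₂ (nodeCount* ts) + b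
    -- Adding the root increases the binomial coefficient by the old number of vertices, `a + b`
    -- modulo 2, and moves every vertex one level down, which replaces `b` by `a`. The two changes
    -- cancel.
    ≡⟨ solve (choose₂ (nodeCount* ts)) a b ⟩
  (choose₂ (nodeCount* ts) + (a + b)) + a
    ≡⟨ cong (λ c → (choose₂ (nodeCount* ts) + c) + a) (ℙ.+-homo-+ (level* 0ℙ ts) (level* 1ℙ ts)) ⟨
  (choose₂ (nodeCount* ts) + parity (level* 0ℙ ts ℕ.+ level* 1ℙ ts)) + a
    ≡⟨ cong (λ k → (choose₂ (nodeCount* ts) + parity k) + a) (nodeCount*-level* ts) ⟨
  (choose₂ (nodeCount* ts) + parity (nodeCount* ts)) + a ∎
  where
  a = parity (level* 0ℙ ts)
  b = parity (level* 1ℙ ts)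
  solve : ∀ c a b → c + b ≡ (c + (a + b)) + a
  solve c a b = ≡.sym (≡.trans (ℙ.+-assoc c (a + b) a) (cong (c +_)
    (≡.trans (cong (_+ a) (ℙ.+-comm a b)) (+-cancel-twice b a))))
parity-codes []       = ≡.refl
parity-codes (t ∷ ts) = begin
  parity (inversions (code t ++ codes ts))
    ≡⟨ cong parity (inversions-++ (code t) (codes ts)) ⟩
  parity (i ℕ.+ j ℕ.+ closings (code t) ℕ.* openings (codes ts))
    ≡⟨ cong₂ (λ a b → parity (i ℕ.+ j ℕ.+ a ℕ.* b)) (closings-code t) (openings-codes ts) ⟩
  parity (i ℕ.+ j ℕ.+ m ℕ.* n)
    ≡⟨ ℙ.+-homo-+ (i ℕ.+ j) (m ℕ.* n) ⟩
  parity (i ℕ.+ j) + parity (m ℕ.* n)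
    ≡⟨ cong₂ _+_ (ℙ.+-homo-+ i j) (ℙ.*-homo-* m n) ⟩
  (parity i + parity j) + (parity m * parity n)
    ≡⟨ cong (_+ (parity m * parity n)) (cong₂ _+_ (parity-code t) (parity-codes ts)) ⟩
  ((choose₂ m + a) + (choose₂ n + b)) + (parity m * parity n)
    -- The inversions between `t` and `ts` match the pairs with one vertex in each.
    ≡⟨ solve (choose₂ m) a (choose₂ n) b (parity m * parity n) ⟩
  ((choose₂ m + choose₂ n) + (parity m * parity n)) + (a + b)
    ≡⟨ cong₂ _+_ (choose₂-+ m n) (ℙ.+-homo-+ (level 1ℙ t) (level* 1ℙ ts)) ⟨
  choose₂ (m ℕ.+ n) + parity (level 1ℙ t ℕ.+ level* 1ℙ ts) ∎
  where
  i = inversions (code t)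
  j = inversions (codes ts)
  m = nodeCount t
  n = nodeCount* ts
  a = parity (level 1ℙ t)
  b = parity (level* 1ℙ ts)
  solve : ∀ c a d b e → ((c + a) + (d + b)) + e ≡ ((c + d) + e) + (a + b)
  solve c a d b e = ≡.trans (cong (_+ e) (interchange c a d b))
    (≡.trans (ℙ.+-assoc (c + d) (a + b) e)
    (≡.trans (cong ((c + d) +_) (ℙ.+-comm (a + b) e)) (≡.sym (ℙ.+-assoc (c + d) e (a + b)))))

-- Counting occurrences

open ListSum ℕ.+-0-isCommutativeMonoid using ()
  renaming (∑ to ∑ℕ; ∑-cong to ∑ℕ-cong; ∑-map to ∑ℕ-map; ∑-++ to ∑ℕ-++;
            ∑-↭ to ∑ℕ-↭; ∑-swap to ∑ℕ-swap)

module Count {X : Set} (_≟_ : DecidableEquality X) where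

  δ : X → X → ℕ
  δ x y = if does (x ≟ y) then 1 else 0

  count : X → List X → ℕ
  count x = ∑ℕ (δ x)

  δ-sym : ∀ x y → δ x y ≡ δ y x
  δ-sym x y with x ≟ y | y ≟ x
  ... | yes _   | yes _   = ≡.refl
  ... | no _    | no _    = ≡.refl
  ... | yes x≡y | no y≢x = ⊥-elim (y≢x (≡.sym x≡y))
  ... | no x≢y  | yes y≡x = ⊥-elim (x≢y (≡.sym y≡x))

  count-∉ : ∀ {x ys} → x ∉ ys → count x ys ≡ 0
  count-∉ {ys = []}         _ = ≡.refl
  count-∉ {x} {ys = y ∷ ys} p with x ≟ y
  ... | yes x≡y = ⊥-elim (p (here x≡y))
  ... | no _    = count-∉ (p ∘ there)

  ∉-count : ∀ {x ys} → count x ys ≡ 0 → x ∉ ys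
  ∉-count {x} {y ∷ ys} p q with x ≟ y
  ∉-count {x} {y ∷ ys} () q         | yes _
  ∉-count {x} {y ∷ ys} p (here x≡y) | no x≢y = x≢y x≡y
  ∉-count {x} {y ∷ ys} p (there q)  | no _    = ∉-count p q

  count-∈ : ∀ {x ys} → Unique ys → x ∈ ys → count x ys ≡ 1
  count-∈ {x} {y ∷ ys} (fresh ∷ u) p with x ≟ y
  count-∈ {x} {y ∷ ys} (fresh ∷ u) p         | yes ≡.refl =
    cong suc (count-∉ λ q → All.lookup fresh q ≡.refl)
  count-∈ {x} {y ∷ ys} (fresh ∷ u) (here x≡y) | no x≢y = ⊥-elim (x≢y x≡y)
  count-∈ {x} {y ∷ ys} (fresh ∷ u) (there p)  | no _    = count-∈ u p

  ∈-count : ∀ {x ys k} → count x ys ≡ suc k → x ∈ ys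
  ∈-count {x} {y ∷ ys} p with x ≟ y
  ... | yes x≡y = here x≡y
  ... | no _    = there (∈-count p)

  count-unique : ∀ ys → (∀ x → count x ys ≤ 1) → Unique ys
  count-unique []       _ = []
  count-unique (y ∷ ys) p =
    All.tabulate (λ {x} q y≡x → ∉-count (once y (p y)) (subst (_∈ ys) (≡.sym y≡x) q)) ∷
    count-unique ys (λ x → ℕ.≤-trans (ℕ.m≤n+m _ (δ x y)) (p x))
    where
    once : ∀ x → count x (x ∷ ys) ≤ 1 → count x ys ≡ 0
    once x q with x ≟ x
    once x (s≤s z≤n′) | yes _ = ℕ.n≤0⇒n≡0 z≤n′
    once x _          | no ¬p = ⊥-elim (¬p ≡.refl)

  count-map : ∀ {f : X → X} → Injective _≡_ _≡_ f → ∀ x ys → count (f x) (map f ys) ≡ count x ys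
  count-map {f} inj x ys = ≡.trans (∑ℕ-map (δ (f x)) f ys) (∑ℕ-cong δ-inj ys)
    where
    δ-inj : ∀ y → δ (f x) (f y) ≡ δ x y
    δ-inj y with f x ≟ f y | x ≟ y
    ... | yes _ | yes _ = ≡.refl
    ... | no _  | no _  = ≡.refl
    ... | yes p | no q  = ⊥-elim (q (inj p))
    ... | no p  | yes q = ⊥-elim (p (cong f q))

  -- Double counting of the positions of `ys`, grouped by the element that stands there.
  length-constant : ∀ {n k} → X ↔ Fin n → ∀ ys → (∀ x → count x ys ≡ k) → length ys ≡ n ℕ.* k
  length-constant {n} {k} enum ys p = begin
    length ys
      ≡⟨ ∑ℕ-1 ys ⟨
    ∑ℕ (λ _ → 1) ys
      ≡⟨ ∑ℕ-cong (λ y → count-∈ all-unique (∈-all y)) ys ⟨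
    ∑ℕ (λ y → count y all) ys
      ≡⟨ ∑ℕ-swap δ ys all ⟩
    ∑ℕ (λ x → ∑ℕ (λ y → δ y x) ys) all
      ≡⟨ ∑ℕ-cong (λ x → ≡.trans (∑ℕ-cong (λ y → δ-sym y x) ys) (p x)) all ⟩
    ∑ℕ (λ _ → k) all
      ≡⟨ ∑ℕ-const all ⟩
    length all ℕ.* k
      ≡⟨ cong (ℕ._* k) length-all ⟩
    n ℕ.* k ∎
    where
    all : List X
    all = map (Inverse.from enum) (allFin n)
    length-all : length all ≡ n
    length-all = ≡.trans (length-map (Inverse.from enum) (allFin n)) (length-tabulate {n = n} id)
    all-unique : Unique all
    all-unique = Unique.map⁺ (Injection.injective (↔⇒↣ (↔-sym enum))) (Unique.allFin⁺ n)
    ∈-all : ∀ x → x ∈ all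
    ∈-all x = subst (_∈ all) (Inverse.inverseʳ enum ≡.refl)
      (∈-map⁺ (Inverse.from enum) (∈-allFin (Inverse.to enum x)))
    ∑ℕ-const : ∀ {c} (xs : List X) → ∑ℕ (λ _ → c) xs ≡ length xs ℕ.* c
    ∑ℕ-const []       = ≡.refl
    ∑ℕ-const (x ∷ xs) = cong (_ ℕ.+_) (∑ℕ-const xs)
    ∑ℕ-1 : (xs : List X) → ∑ℕ (λ _ → 1) xs ≡ length xs
    ∑ℕ-1 xs = ≡.trans (∑ℕ-const xs) (ℕ.*-identityʳ _)

-- Plane trees

module Tree (T : PlaneTree) where
  open PlaneTree T

  rev-involutive : ∀ d → rev (rev d) ≡ d
  rev-involutive (e , b) = cong (e ,_) (not-involutive b)

  rev-injective : Injective _≡_ _≡_ rev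
  rev-injective {x} {y} p =
    ≡.trans (≡.sym (rev-involutive x)) (≡.trans (cong rev p) (rev-involutive y))

  -- For a complete turn, `d₀ = d`, this is the equation required by `Cyclic`; the induction needs
  -- an arbitrary starting dart.
  sweep-map : ∀ {d₀ d ds} → Sweep T d₀ d ds → ∃[ ys ] ds ≡ d ∷ ys × map next ds ≡ ys ∷ʳ d₀
  sweep-map (stop p) = [] , ≡.refl , cong (_∷ []) p
  sweep-map (step _ sw) with ys , ≡.refl , p ← sweep-map sw = _ , ≡.refl , cong (_ ∷_) p

  -- If `d` recurred later, so would `next d` among the successors of the remaining darts. These are
  -- the darts after `next d`, excluded by induction, and `d₀`, excluded because the sweep did not
  -- stop at `d`.
  sweep-unique : ∀ {d₀ d ds} → Sweep T d₀ d ds → Unique ds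
  sweep-unique (stop _) = [] ∷ []
  sweep-unique {d₀} {d} (step {ds = ds} d≢ sw) = All.tabulate fresh ∷ sweep-unique sw
    where
    fresh : ∀ {x} → x ∈ ds → d ≢ x
    fresh {x} p ≡.refl with sweep-map sw | sweep-unique sw
    ... | ys , ≡.refl , q | u ∷ _ with ∈-++⁻ ys (subst (next d ∈_) q (∈-map⁺ next p))
    ...   | inj₁ r        = All.lookup u r ≡.refl
    ...   | inj₂ (here r) = d≢ r

  sweep-tail : ∀ {d₀ d ds} → Sweep T d₀ d ds → All (λ x → tail x ≡ tail d) ds
  sweep-tail (stop _)    = ≡.refl ∷ []
  sweep-tail (step _ sw) = ≡.refl ∷ All.map (λ p → ≡.trans p (next-tail _)) (sweep-tail sw)

  around-↭ : ∀ {d ds} → Around T d ds → map next ds ↭ ds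
  around-↭ {d} sw with ys , ≡.refl , p ← sweep-map sw =
    ↭-trans (↭-reflexive p) (↭-sym (∷↭∷ʳ d ys))

  -- The list is closed under `next`, which reaches every dart with the same tail.
  around-∈ : ∀ {d ds x} → Around T d ds → tail x ≡ tail d → x ∈ ds
  around-∈ {d} {ds} {x} sw p with next-cyclic d x (≡.sym p) | sweep-map sw
  ... | i , ≡.refl | _ , ≡.refl , _ = closed i (here ≡.refl)
    where
    closed : ∀ i {y} → y ∈ ds → iterate next y i ∈ ds
    closed zero    q = q
    closed (suc i) q = closed i (∈-resp-↭ (around-↭ sw) (∈-map⁺ next q))

  Cycle : Set
  Cycle = ∃[ d ] ∃[ ds ] Around T d ds

  vertex : Cycle → V
  vertex (d , _) = tail d

  darts : Cycle → List Dart
  darts (_ , ds , _) = ds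

  allDarts : List Cycle → List Dart
  allDarts cs = concat (map darts cs)

  allDarts-++ : ∀ cs cs′ → allDarts (cs ++ cs′) ≡ allDarts cs ++ allDarts cs′
  allDarts-++ cs cs′ = ≡.trans (cong concat (map-++ darts cs cs′))
    (≡.sym (concat-++ (map darts cs) (map darts cs′)))

  -- Depths are taken relative to head d, so that tail d has parity 1ℙ.
  hungCycles   : ∀ {d t} → Parity → Hangs T d t → List Cycle
  hungCycles*  : ∀ {ds ts} → Parity → Pointwise (Hangs T) ds ts → List Cycle
  hungCycles 0ℙ (hangs around hs) = (_ , _ , around) ∷ hungCycles* 1ℙ hs
  hungCycles 1ℙ (hangs around hs) = hungCycles* 0ℙ hs
  hungCycles* b []                = []
  hungCycles* b (h ∷ hs)          = hungCycles b h ++ hungCycles* b hs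

  -- The darts listed by edges instead of vertices: every edge of the subtree, and the edge of `d`
  -- leading to it, gives one of its two darts to each parity.
  hungDarts  : ∀ {d t} → Parity → Hangs T d t → List Dart
  hungDarts* : ∀ {ds ts} → Parity → Pointwise (Hangs T) ds ts → List Dart
  hungDarts 0ℙ (hangs {d} _ hs) = rev d ∷ hungDarts* 1ℙ hs
  hungDarts 1ℙ (hangs {d} _ hs) = d ∷ hungDarts* 0ℙ hs
  hungDarts* b []               = []
  hungDarts* b (h ∷ hs)         = hungDarts b h ++ hungDarts* b hs

  -- Compares the listings by edges and by vertices. In parity `1ℙ` the dart `d` is left over, since
  -- it starts at the parent, whose cycle is not part of the subtree.
  hungDarts-0  : ∀ {d t} (h : Hangs T d t) → hungDarts 0ℙ h ↭ allDarts (hungCycles 0ℙ h)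
  hungDarts-1  : ∀ {d t} (h : Hangs T d t) → hungDarts 1ℙ h ↭ d ∷ allDarts (hungCycles 1ℙ h)
  hungDarts*-0 : ∀ {ds ts} (hs : Pointwise (Hangs T) ds ts) →
                 hungDarts* 0ℙ hs ↭ allDarts (hungCycles* 0ℙ hs)
  hungDarts*-1 : ∀ {ds ts} (hs : Pointwise (Hangs T) ds ts) →
                 hungDarts* 1ℙ hs ↭ ds ++ allDarts (hungCycles* 1ℙ hs)
  hungDarts-0 (hangs _ hs) = prep _ (hungDarts*-1 hs)
  hungDarts-1 (hangs _ hs) = prep _ (hungDarts*-0 hs)
  hungDarts*-0 [] = refl
  hungDarts*-0 (h ∷ hs) = ↭-trans (++⁺ (hungDarts-0 h) (hungDarts*-0 hs))
    (↭-reflexive (≡.sym (allDarts-++ (hungCycles 0ℙ h) _)))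
  hungDarts*-1 [] = refl
  hungDarts*-1 {_ ∷ ds} (h ∷ hs) = ↭-trans (++⁺ (hungDarts-1 h) (hungDarts*-1 hs))
    (prep _ (↭-trans (shifts (allDarts (hungCycles 1ℙ h)) ds)
      (↭-reflexive (cong (ds ++_) (≡.sym (allDarts-++ (hungCycles 1ℙ h) _))))))

  rev-hungDarts  : ∀ {d t} b (h : Hangs T d t) → map rev (hungDarts b h) ≡ hungDarts (b ⁻¹) h
  rev-hungDarts* : ∀ {ds ts} b (hs : Pointwise (Hangs T) ds ts) →
                   map rev (hungDarts* b hs) ≡ hungDarts* (b ⁻¹) hs
  rev-hungDarts 0ℙ (hangs _ hs) = cong₂ _∷_ (rev-involutive _) (rev-hungDarts* 1ℙ hs)
  rev-hungDarts 1ℙ (hangs _ hs) = cong (_ ∷_) (rev-hungDarts* 0ℙ hs)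
  rev-hungDarts* b [] = ≡.refl
  rev-hungDarts* b (h ∷ hs) = ≡.trans (map-++ rev (hungDarts b h) _)
    (cong₂ _++_ (rev-hungDarts b h) (rev-hungDarts* b hs))

  length-hungCycles  : ∀ {d t} b (h : Hangs T d t) → length (hungCycles b h) ≡ level b t
  length-hungCycles* : ∀ {ds ts} b (hs : Pointwise (Hangs T) ds ts) →
                       length (hungCycles* b hs) ≡ level* b ts
  length-hungCycles 0ℙ (hangs _ hs) = cong suc (length-hungCycles* 1ℙ hs)
  length-hungCycles 1ℙ (hangs _ hs) = length-hungCycles* 0ℙ hs
  length-hungCycles* b [] = ≡.refl
  length-hungCycles* b (h ∷ hs) = ≡.trans (length-++ (hungCycles b h))
    (cong₂ ℕ._+_ (length-hungCycles b h) (length-hungCycles* b hs))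

  length-hungDarts  : ∀ {d t} b (h : Hangs T d t) → length (hungDarts b h) ≡ nodeCount t
  length-hungDarts* : ∀ {ds ts} b (hs : Pointwise (Hangs T) ds ts) →
                      length (hungDarts* b hs) ≡ nodeCount* ts
  length-hungDarts 0ℙ (hangs _ hs) = cong suc (length-hungDarts* 1ℙ hs)
  length-hungDarts 1ℙ (hangs _ hs) = cong suc (length-hungDarts* 0ℙ hs)
  length-hungDarts* b [] = ≡.refl
  length-hungDarts* b (h ∷ hs) = ≡.trans (length-++ (hungDarts b h))
    (cong₂ ℕ._+_ (length-hungDarts b h) (length-hungDarts* b hs))

  module _ {A : Set} (f : Dart → A) (invariant : ∀ d → f (next (rev d)) ≡ f d) {c : A} where

    -- The walk d ↦ next (rev d) goes around each hanging subtree.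
    contour  : ∀ {d t} (h : Hangs T d t) → f d ≡ c →
               f (rev d) ≡ c × (∀ b → All (λ x → f x ≡ c) (hungDarts b h))
    contour* : ∀ {d₀ d ds ts} → Sweep T d₀ d ds → (hs : Pointwise (Hangs T) ds ts) → f d ≡ c →
               f d₀ ≡ c × (∀ b → All (λ x → f x ≡ c) (hungDarts* b hs))
    contour {d} (hangs (stop p) []) q = r , λ { 0ℙ → r ∷ [] ; 1ℙ → q ∷ [] }
      where
      r : f (rev d) ≡ c
      r = ≡.trans (cong f (≡.sym p)) (≡.trans (invariant d) q)
    contour {d} (hangs (step _ sw) hs) q with contour* sw hs (≡.trans (invariant d) q)
    ... | r , all = r , λ { 0ℙ → r ∷ all 1ℙ ; 1ℙ → q ∷ all 0ℙ }
    -- From the last child the walk comes back along `rev d`; its next step leads to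
    -- `next (rev (rev d))`, which is `next d` and so the dart `d₀`.
    contour* {d = d} (stop p) (h ∷ []) q with contour h q
    ... | r , all =
      ≡.trans (cong f (≡.trans (≡.sym p) (cong next (≡.sym (rev-involutive d)))))
        (≡.trans (invariant (rev d)) r) ,
      λ b → All.++⁺ (all b) []
    contour* {d = d} (step _ sw) (h ∷ hs) q with contour h q
    ... | r , all with contour* sw hs (≡.trans (cong f (cong next (≡.sym (rev-involutive d))))
                                       (≡.trans (invariant (rev d)) r))
    ...   | r′ , all′ = r′ , λ b → All.++⁺ (all b) (all′ b)

  module _ (_≟V_ : DecidableEquality V) (_≟D_ : DecidableEquality Dart) where
    private
      module CV = Count _≟V_
      module CD = Count _≟D_

    count-darts : ∀ d c → CD.count d (darts c) ≡ CV.δ (tail d) (vertex c)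
    count-darts d (x , ds , sw) with tail d ≟V tail x
    ... | yes p = CD.count-∈ (sweep-unique sw) (around-∈ sw p)
    ... | no ¬p = CD.count-∉ (λ q → ¬p (All.lookup (sweep-tail sw) q))

    count-allDarts : ∀ d cs → CD.count d (allDarts cs) ≡ CV.count (tail d) (map vertex cs)
    count-allDarts d [] = ≡.refl
    count-allDarts d (c ∷ cs) = ≡.trans (∑ℕ-++ (CD.δ d) (darts c) _)
      (cong₂ ℕ._+_ (count-darts d c) (count-allDarts d cs))

-- The colouring of a plane tree by depth, and the sign of its rotation.

module _ (T : PlaneTree) {n : ℕ} (order≡n : PlaneTree.order T ≡ n)
         (enum : PlaneTree.Dart T ↔ Fin (2 ℕ.* n ∸ 2)) where
  open PlaneTree T
  open Tree T
  open Inverse enum using (to; from)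

  private
    m : ℕ
    m = 2 ℕ.* n ∸ 2

    _≟V_ : DecidableEquality V
    _≟V_ = via-injection (↔⇒↣ finiteV) Fin._≟_

    _≟D_ : DecidableEquality Dart
    _≟D_ = via-injection (↔⇒↣ enum) Fin._≟_

    module CV = Count _≟V_
    module CD = Count _≟D_

  module Rooted {d₀ : Dart} {ds ts} (around : Around T d₀ ds)
                (hs : Pointwise (Hangs T) ds ts) where

    private
      t : PRTree
      t = node ts

    cycles : Parity → List Cycle
    cycles 0ℙ = (d₀ , ds , around) ∷ hungCycles* 1ℙ hs
    cycles 1ℙ = hungCycles* 0ℙ hs

    -- Here `b` refers to the depth below the root, while the hung lists count from the children:
    -- hence the inverted parity.
    dartsAt : Parity → List Dart
    dartsAt b = hungDarts* (b ⁻¹) hs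

    dartsAt-↭ : ∀ b → dartsAt b ↭ allDarts (cycles b)
    dartsAt-↭ 0ℙ = hungDarts*-1 hs
    dartsAt-↭ 1ℙ = hungDarts*-0 hs

    length-cycles : ∀ b → length (cycles b) ≡ level b t
    length-cycles 0ℙ = cong suc (length-hungCycles* 1ℙ hs)
    length-cycles 1ℙ = length-hungCycles* 0ℙ hs

    vertexCount : Parity → V → ℕ
    vertexCount b v = CV.count v (map vertex (cycles b))

    -- A priori t might visit vertices of T repeatedly.  But by connectedness all
    -- vertices, and then all darts, occur equally often, say k times, so that
    -- nodeCount t = n k and nodeCount t − 1 = (n − 1) k, whence k = 1.
    multiplicity : V → ℕ
    multiplicity v = vertexCount 0ℙ v ℕ.+ vertexCount 1ℙ v

    count-dartsAt : ∀ b d → CD.count d (dartsAt b) ≡ vertexCount b (tail d)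
    count-dartsAt b d = ≡.trans (∑ℕ-↭ (CD.δ d) (dartsAt-↭ b))
      (count-allDarts _≟V_ _≟D_ d (cycles b))

    -- A vertex is visited as often as any dart starting there is listed, and reversal interchanges
    -- the darts listed for the two parities.
    vertexCount-head : ∀ b d → vertexCount b (head d) ≡ vertexCount (b ⁻¹) (tail d)
    vertexCount-head b d = begin
      vertexCount b (head d)
        ≡⟨ count-dartsAt b (rev d) ⟨
      CD.count (rev d) (dartsAt b)
        ≡⟨ cong (λ b → CD.count (rev d) (hungDarts* (b ⁻¹) hs)) (ℙ.⁻¹-involutive b) ⟨
      CD.count (rev d) (dartsAt (b ⁻¹ ⁻¹))
        ≡⟨ cong (CD.count (rev d)) (rev-hungDarts* (b ⁻¹ ⁻¹) hs) ⟨
      CD.count (rev d) (map rev (dartsAt (b ⁻¹)))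
        ≡⟨ CD.count-map rev-injective d (dartsAt (b ⁻¹)) ⟩
      CD.count d (dartsAt (b ⁻¹))
        ≡⟨ count-dartsAt (b ⁻¹) d ⟩
      vertexCount (b ⁻¹) (tail d) ∎

    multiplicity-walk : ∀ {u w} ds → IsWalk u ds w → multiplicity u ≡ multiplicity w
    multiplicity-walk []       ≡.refl       = ≡.refl
    multiplicity-walk (d ∷ ds) (≡.refl , p) = ≡.trans
      (≡.trans (ℕ.+-comm (vertexCount 0ℙ (tail d)) _)
        (≡.sym (cong₂ ℕ._+_ (vertexCount-head 0ℙ d) (vertexCount-head 1ℙ d))))
      (multiplicity-walk ds p)

    private
      k : ℕ
      k = multiplicity nonempty

      multiplicity-k : ∀ v → multiplicity v ≡ k
      multiplicity-k v = let ds , p = connected v nonempty in multiplicity-walk ds p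

      nodeCount≡n*k : nodeCount t ≡ n ℕ.* k
      nodeCount≡n*k = begin
        nodeCount t
          ≡⟨ nodeCount-level t ⟩
        level 0ℙ t ℕ.+ level 1ℙ t
          ≡⟨ cong₂ ℕ._+_ (length-cycles 0ℙ) (length-cycles 1ℙ) ⟨
        length (cycles 0ℙ) ℕ.+ length (cycles 1ℙ)
          ≡⟨ cong₂ ℕ._+_ (length-map vertex (cycles 0ℙ)) (length-map vertex (cycles 1ℙ)) ⟨
        length (map vertex (cycles 0ℙ)) ℕ.+ length (map vertex (cycles 1ℙ))
          ≡⟨ length-++ (map vertex (cycles 0ℙ)) ⟨
        length (map vertex (cycles 0ℙ) ++ map vertex (cycles 1ℙ))
          ≡⟨ CV.length-constant finiteV (map vertex (cycles 0ℙ) ++ map vertex (cycles 1ℙ))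
               (λ v → ≡.trans (∑ℕ-++ (CV.δ v) (map vertex (cycles 0ℙ)) (map vertex (cycles 1ℙ)))
                              (multiplicity-k v)) ⟩
        order ℕ.* k
          ≡⟨ cong (ℕ._* k) order≡n ⟩
        n ℕ.* k ∎

      -- The edges of the clean tree are the darts of `T`, so `enum` fixes the number of darts; each
      -- edge of `t` accounts for two.
      2nodeCount*≡m*k : nodeCount* ts ℕ.+ nodeCount* ts ≡ m ℕ.* k
      2nodeCount*≡m*k = begin
        nodeCount* ts ℕ.+ nodeCount* ts
          ≡⟨ cong₂ ℕ._+_ (length-hungDarts* 1ℙ hs) (length-hungDarts* 0ℙ hs) ⟨
        length (dartsAt 0ℙ) ℕ.+ length (dartsAt 1ℙ)
          ≡⟨ length-++ (dartsAt 0ℙ) ⟨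
        length (dartsAt 0ℙ ++ dartsAt 1ℙ)
          ≡⟨ CD.length-constant enum (dartsAt 0ℙ ++ dartsAt 1ℙ) (λ d →
               ≡.trans (∑ℕ-++ (CD.δ d) (dartsAt 0ℙ) (dartsAt 1ℙ))
               (≡.trans (cong₂ ℕ._+_ (count-dartsAt 0ℙ d) (count-dartsAt 1ℙ d))
                        (multiplicity-k (tail d)))) ⟩
        m ℕ.* k ∎

      solve-k : ∀ n s k → suc s ≡ n ℕ.* k → s ℕ.+ s ≡ (2 ℕ.* n ∸ 2) ℕ.* k → k ≡ 1
      solve-k (suc n) s k p q = ≡.sym (ℕ.+-cancelʳ-≡ (n ℕ.* k) 1 k
        (≡.trans (cong suc (≡.sym s≡n*k)) p))
        where
        s≡n*k : s ≡ n ℕ.* k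
        s≡n*k = ℕ.*-cancelˡ-≡ s (n ℕ.* k) 2 (begin
          2 ℕ.* s                    ≡⟨ cong (s ℕ.+_) (ℕ.+-identityʳ s) ⟩
          s ℕ.+ s                    ≡⟨ q ⟩
          (2 ℕ.* suc n ∸ 2) ℕ.* k    ≡⟨ cong (λ a → (a ∸ 2) ℕ.* k) (ℕ.*-suc 2 n) ⟩
          2 ℕ.* n ℕ.* k              ≡⟨ ℕ.*-assoc 2 n k ⟩
          2 ℕ.* (n ℕ.* k)            ∎)

      k≡1 : k ≡ 1
      k≡1 = solve-k n (nodeCount* ts) k nodeCount≡n*k 2nodeCount*≡m*k

    multiplicity-1 : ∀ v → multiplicity v ≡ 1
    multiplicity-1 v = ≡.trans (multiplicity-k v) k≡1

    nodeCount≡n : nodeCount t ≡ n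
    nodeCount≡n = ≡.trans nodeCount≡n*k (≡.trans (cong (n ℕ.*_) k≡1) (ℕ.*-identityʳ n))

    -- As each vertex is visited exactly once, this is the parity of its depth.
    colour : V → Parity
    colour v = parity (vertexCount 1ℙ v)

    private
      sum≡1 : ∀ a b → a ℕ.+ b ≡ 1 → (a ≡ 1 × b ≡ 0) ⊎ (a ≡ 0 × b ≡ 1)
      sum≡1 zero          b p = inj₂ (≡.refl , p)
      sum≡1 (suc zero) zero p = inj₁ (≡.refl , ≡.refl)

      split : ∀ v → (vertexCount 0ℙ v ≡ 1 × vertexCount 1ℙ v ≡ 0) ⊎
                    (vertexCount 0ℙ v ≡ 0 × vertexCount 1ℙ v ≡ 1)
      split v = sum≡1 (vertexCount 0ℙ v) (vertexCount 1ℙ v) (multiplicity-1 v)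

    vertexCount-colour : ∀ b v → colour v ≡ b → vertexCount b v ≡ 1
    vertexCount-colour b v p with split v
    vertexCount-colour 0ℙ v p | inj₁ (q , _) = q
    vertexCount-colour 1ℙ v p | inj₁ (_ , q) with () ← ≡.trans (≡.sym p) (cong parity q)
    vertexCount-colour 0ℙ v p | inj₂ (_ , q) with () ← ≡.trans (≡.sym p) (cong parity q)
    vertexCount-colour 1ℙ v p | inj₂ (_ , q) = q

    colour-vertexCount : ∀ b v → vertexCount b v ≢ 0 → colour v ≡ b
    colour-vertexCount b v p with split v
    colour-vertexCount 0ℙ v p | inj₁ (_ , q) = cong parity q
    colour-vertexCount 1ℙ v p | inj₁ (_ , q) = ⊥-elim (p q)
    colour-vertexCount 0ℙ v p | inj₂ (q , _) = ⊥-elim (p q)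
    colour-vertexCount 1ℙ v p | inj₂ (_ , q) = cong parity q

    colour-head : ∀ d → colour (head d) ≡ colour (tail d) + 1ℙ
    colour-head d with split (tail d)
    ... | inj₁ (p , q) = ≡.trans (cong parity (≡.trans (vertexCount-head 1ℙ d) p))
                                 (cong (λ c → parity c + 1ℙ) (≡.sym q))
    ... | inj₂ (p , q) = ≡.trans (cong parity (≡.trans (vertexCount-head 1ℙ d) p))
                                 (cong (λ c → parity c + 1ℙ) (≡.sym q))

    dartsAt-unique : ∀ b → Unique (dartsAt b)
    dartsAt-unique b = CD.count-unique (dartsAt b) λ d →
      subst (_≤ 1) (≡.sym (count-dartsAt b d))
        (subst (vertexCount b (tail d) ≤_) (multiplicity-1 (tail d)) (bound b (tail d)))
      where
      bound : ∀ b v → vertexCount b v ≤ multiplicity v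
      bound 0ℙ v = ℕ.m≤m+n _ _
      bound 1ℙ v = ℕ.m≤n+m _ _

    ∈-dartsAt⁺ : ∀ {b d} → colour (tail d) ≡ b → d ∈ dartsAt b
    ∈-dartsAt⁺ {b} {d} p =
      CD.∈-count (≡.trans (count-dartsAt b d) (vertexCount-colour b (tail d) p))

    ∈-dartsAt⁻ : ∀ {b d} → d ∈ dartsAt b → colour (tail d) ≡ b
    ∈-dartsAt⁻ {b} {d} p = colour-vertexCount b (tail d) λ q →
      CD.∉-count (≡.trans (count-dartsAt b d) q) p

    -- Transitivity of `next ∘ rev`, stated through its invariant functions: the walk around `t`
    -- covers all the listed darts, and every dart is listed.
    constant : {A : Set} (f : Dart → A) → (∀ d → f (next (rev d)) ≡ f d) →
               ∀ d → f d ≡ f d₀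
    constant f p d = All.lookup (proj₂ (contour* f p around hs ≡.refl) (colour (tail d) ⁻¹))
      (∈-dartsAt⁺ ≡.refl)

  open PlaneBipartiteTree (clean T) using (s)

  -- The sign is `1ℙ` plus the parity of the number of vertices of odd depth. Expressed through
  -- `parity-code`, it depends on the tree only through `prParity t` once `n` is fixed.
  bicoloured : parity n ≡ 0ℙ → ∀ {d t} → RootedAt T d t →
               Bicoloured (s white enum) (s black enum)
                 (1ℙ + (prParity t + choose₂ n))
  bicoloured even-n (rooted {d₀} {ds} {ts} around hs) = record
    { point        = to d₀
    ; κ            = κ
    ; κ-ρ          = λ x → cong R.colour (≡.trans (cong tail (from-to _)) (next-tail (from x)))
    ; κ-α          = λ x → ≡.trans (cong (R.colour ∘ tail) (from-to _)) (R.colour-head (from x))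
    ; α-involutive = λ x → ≡.trans (cong (to ∘ rev) (from-to _))
                       (≡.trans (cong to (rev-involutive (from x))) (to-from x))
    ; cyclic       = λ f p x y → ≡.trans (constant f p x) (≡.sym (constant f p y))
    ; sign         = sign
    }
    where
    module R = Rooted around hs
    t : PRTree
    t = node ts

    ρ = s white enum
    α = s black enum

    from-to : ∀ d → from (to d) ≡ d
    from-to d = Inverse.inverseʳ enum ≡.refl

    to-from : ∀ x → to (from x) ≡ x
    to-from x = Inverse.inverseˡ enum ≡.refl

    to-injective : Injective _≡_ _≡_ to
    to-injective = Injection.injective (↔⇒↣ enum)

    κ : Fin m → Parity
    κ x = R.colour (tail (from x))

    constant : (f : Fin m → Parity) → (∀ x → f (ρ ⟨$⟩ʳ (α ⟨$⟩ʳ x)) ≡ f x) →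
               ∀ x → f x ≡ f (to d₀)
    constant f p x = ≡.trans (cong f (≡.sym (to-from x)))
      (R.constant (f ∘ to) invariant (from x))
      where
      invariant : ∀ d → f (to (next (rev d))) ≡ f (to d)
      invariant d = begin
        f (to (next (rev d)))
          ≡⟨ cong (f ∘ to ∘ next) (≡.trans (from-to _) (cong rev (from-to d))) ⟨
        f (ρ ⟨$⟩ʳ (α ⟨$⟩ʳ to d))
          ≡⟨ p (to d) ⟩
        f (to d) ∎

    class-↭ : ∀ b → class κ b ↭ map to (R.dartsAt b)
    class-↭ b = unique∧set⇒↭ (class-unique κ b) (Unique.map⁺ to-injective (R.dartsAt-unique b))
      (λ {x} p → subst (_∈ _) (to-from x) (∈-map⁺ to (R.∈-dartsAt⁺ (∈-class⁻ κ p))))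
      (λ {x} p → let d , q , eq = ∈-map⁻ to p in ∈-class⁺ κ
        (≡.trans (cong (R.colour ∘ tail) (≡.trans (cong from eq) (from-to d))) (R.∈-dartsAt⁻ q)))

    cyclic-darts : ∀ c → Cyclic (ρ ⟨$⟩ʳ_) (map to (darts c))
    cyclic-darts (d , ds , sw) with ys , ≡.refl , p ← sweep-map sw =
      to d , map to ys , ≡.refl , rotates , Unique.map⁺ to-injective (sweep-unique sw)
      where
      rotates : map (ρ ⟨$⟩ʳ_) (map to ds) ≡ map to ys ∷ʳ to d
      rotates = begin
        map (ρ ⟨$⟩ʳ_) (map to ds)   ≡⟨ map-∘ ds ⟨
        map (λ x → ρ ⟨$⟩ʳ to x) ds  ≡⟨ map-cong (λ x → cong (to ∘ next) (from-to x)) ds ⟩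
        map (to ∘ next) ds          ≡⟨ map-∘ ds ⟩
        map to (map next ds)        ≡⟨ cong (map to) p ⟩
        map to (ys ∷ʳ d)            ≡⟨ map-++ to ys (d ∷ []) ⟩
        map to ys ∷ʳ to d           ∎

    -- The cycles of `ρ` on one class, one for each vertex of that colour.
    blocks : Parity → List (List (Fin m))
    blocks b = map (map to) (map darts (R.cycles b))

    class-blocks : ∀ b → class κ b ↭ concat (blocks b)
    class-blocks b = ↭-trans (class-↭ b) (↭-trans (map⁺ to (R.dartsAt-↭ b))
      (↭-reflexive (≡.sym (concat-map (map darts (R.cycles b))))))

    length-blocks : ∀ b → length (blocks b) ≡ level b t
    length-blocks b = ≡.trans (length-map (map to) (map darts (R.cycles b)))
      (≡.trans (length-map darts (R.cycles b)) (R.length-cycles b))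

    length-concat-blocks : ∀ b → length (concat (blocks b)) ≡ nodeCount* ts
    length-concat-blocks b = begin
      length (concat (blocks b))
        ≡⟨ ↭-length (class-blocks b) ⟨
      length (class κ b)
        ≡⟨ ↭-length (class-↭ b) ⟩
      length (map to (R.dartsAt b))
        ≡⟨ length-map to (R.dartsAt b) ⟩
      length (R.dartsAt b)
        ≡⟨ length-hungDarts* (b ⁻¹) hs ⟩
      nodeCount* ts ∎

    even-size : parity (nodeCount t) ≡ 0ℙ
    even-size = ≡.trans (cong parity R.nodeCount≡n) even-n

    odd-sizes : parity (nodeCount* ts) ≡ 1ℙ
    odd-sizes = ≡.trans (≡.sym (ℙ.suc-homo-⁻¹ (nodeCount* ts))) (cong _⁻¹ even-size)

    -- The two levels together have an even number of vertices.
    level-parity : ∀ b → parity (level b t) ≡ parity (level 1ℙ t)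
    level-parity 1ℙ = ≡.refl
    level-parity 0ℙ = +≡0⇒≡ _ _ (≡.trans (≡.sym (ℙ.+-homo-+ (level 0ℙ t) (level 1ℙ t)))
      (≡.trans (cong parity (≡.sym (nodeCount-level t))) even-size))

    parity-level : parity (level 1ℙ t) ≡ prParity t + choose₂ n
    parity-level = begin
      b                        ≡⟨ cancel (choose₂ (nodeCount t)) b ⟩
      (choose₂ (nodeCount t) + b) + choose₂ (nodeCount t)
        ≡⟨ cong₂ (λ p n → p + choose₂ n) (≡.sym (parity-code t)) R.nodeCount≡n ⟩
      prParity t + choose₂ n ∎
      where
      b = parity (level 1ℙ t)
      cancel : ∀ c b → b ≡ (c + b) + c
      cancel 0ℙ b  = ≡.sym (ℙ.+-identityʳ b)
      cancel 1ℙ 0ℙ = ≡.refl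
      cancel 1ℙ 1ℙ = ≡.refl

    sign : ∀ b → sgnₚ ρ (class κ b) ≡ 1ℙ + (prParity t + choose₂ n)
    sign b = begin
      sgnₚ ρ (class κ b)
        ≡⟨ sgnₚ-↭ ρ (class-blocks b) ⟩
      sgnₚ ρ (concat (blocks b))
        ≡⟨ sgn-cycles less less-tournament
             (All.map⁺ (All.map⁺ (All.tabulate {xs = R.cycles b} λ {c} _ → cyclic-darts c))) ⟩
      parity (length (concat (blocks b))) + parity (length (blocks b))
        ≡⟨ cong₂ (λ a c → parity a + parity c) (length-concat-blocks b) (length-blocks b) ⟩
      parity (nodeCount* ts) + parity (level b t)
        ≡⟨ cong₂ _+_ odd-sizes (≡.trans (level-parity b) parity-level) ⟩
      1ℙ + (prParity t + choose₂ n) ∎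

-- Comparison of the two trees.

≡-from-0 : ∀ {p q} → (p ≡ 0ℙ → q ≡ 0ℙ) → (q ≡ 0ℙ → p ≡ 0ℙ) → p ≡ q
≡-from-0 {0ℙ} {q}  f g = ≡.sym (f ≡.refl)
≡-from-0 {1ℙ} {0ℙ} f g = g ≡.refl
≡-from-0 {1ℙ} {1ℙ} f g = ≡.refl

proposition6p1 : (n : ℕ) → 2 ∣ n →
    (T U : PlaneTree) → PlaneTree.order T ≡ n → PlaneTree.order U ≡ n →
    (p q : Parity) → HasParity T p → HasParity U q → p ≢ q →
    (enumT : PlaneBipartiteTree.E (clean T) ↔ Fin (2 ℕ.* n ∸ 2)) →
    (enumU : PlaneBipartiteTree.E (clean U) ↔ Fin (2 ℕ.* n ∸ 2)) →
    ¬ (rotationGroup (clean T) enumT ≐ rotationGroup (clean U) enumU)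
proposition6p1 n (divides r n≡r*2) T U order-T order-U p q
  (_ , t , root-t , ≡.refl) (_ , u , root-u , ≡.refl) p≢q enumT enumU (T⊆U , U⊆T) =
  -- By the two inclusions each sign vanishes when the other does, so the signs agree; the summands
  -- `1ℙ` and `choose₂ n` are common to both trees and cancel.
  p≢q (ℙ.+-cancelʳ-≡ (choose₂ n) p q (ℙ.+-cancelˡ-≡ 1ℙ _ _ (≡-from-0
    (λ eq → even-⊆ BU (subst (Bicoloured _ _) eq BT) U⊆T)
    (λ eq → even-⊆ BT (subst (Bicoloured _ _) eq BU) T⊆U))))
  where
  even-n : parity n ≡ 0ℙ
  even-n = ≡.trans (cong parity n≡r*2) (≡.trans (ℙ.*-homo-* r 2) (ℙ.*-zeroʳ (parity r)))

  BT = bicoloured T order-T enumT even-n root-t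
  BU = bicoloured U order-U enumU even-n root-u
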